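{- Let $\alpha$ be a composition of $n$. Then (1) $\psi(\mathcal p_\alpha)=(-1)^{n-\ell(\alpha)}\mathcal p^r_\alpha$; (2) $\rho(\mathcal p_\alpha)=\mathcal p^r_{\alpha^r}$; (3) $\omega(\mathcal p_\alpha)=(-1)^{n-\ell(\alpha)}\mathcal p_{\alpha^r}$.
   Context: Let $\mathbb N=\{1,2,\dots\}$. A composition $\alpha=\alpha_1\cdots\alpha_\ell$ of $n$ ($\alpha\vDash n$) is a sequence of positive integers summing to $n$, $\ell=\ell(\alpha)$. $\mathrm{set}(\alpha)=\{\alpha_1,\alpha_1+\alpha_2,\dots,\alpha_1+\dots+\alpha_{\ell-1}\}\subseteq[n-1]$, with inverse bijection $\mathrm{comp}$. Reversal $\alpha^r=\alpha_\ell\cdots\alpha_1$; complement $\alpha^c=\mathrm{comp}([n-1]\setminus\mathrm{set}(\alpha))$; transpose $\alpha^t=(\alpha^r)^c$. The fundamental quasisymmetric function is $F_\alpha=\sum x_{i_1}\cdots x_{i_n}$ over $i_1\le\dots\le i_n$ with $i_j<i_{j+1}$ whenever $j\in\mathrm{set}(\alpha)$. $\psi,\rho,\omega$ are the linear maps $\mathrm{QSym}\to\mathrm{QSym}$ with $\psi(F_\alpha)=F_{\alpha^c}$, $\rho(F_\alpha)=F_{\alpha^r}$, $\omega(F_\alpha)=F_{\alpha^t}$. A labelling of a finite poset $P$ is an injective map $\gamma$ into a chain; a weight function is $w:P\to\mathbb N$. A $(P,\gamma)$-partition is $f:P\to\mathbb N$ with, for all $p<q$, $f(p)\le f(q)$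 and $f(p)=f(q)\Rightarrow\gamma(p)<\gamma(q)$. $K_{(P,\gamma,w)}=\sum_f\prod_{u\in P}x_{f(u)}^{w(u)}$ over all $(P,\gamma)$-partitions. For a chain $u_1<\dots<u_\ell$, $\alpha(s,w)=(w(u_1),\dots,w(u_\ell))$. Let $\mathbb N_{\mathbb N}=\{a_k:a,k\in\mathbb N\}$ ordered by $a_k<b_l$ iff $a<b$, or $a=b$ and $k<l$; $\mathbb N_{\mathbb N}^*$ is the same set with reversed order. For $\widetilde\alpha$ (parts of $\alpha$ sorted decreasingly) $=m^{r_m}\cdots1^{r_1}$, $P^{\widetilde\alpha}$ is the antichain on $\{a_k:1\le a\le m,1\le k\le r_a\}$ with $w(a_k)=a$, labelling $\gamma:P^{\widetilde\alpha}\to\mathbb N_{\mathbb N}^*$ the inclusion, and dual labelling $\gamma^*:P^{\widetilde\alpha}\to\mathbb N_{\mathbb N}$ the inclusion. Define $\mathcal p_\alpha=\sum_sK_{(s,\gamma,w)}$ and $\mathcal p^r_\alpha=\sum_sK_{(s,\gamma^*,w)}$, both summed over linear extensions $s$ of $P^{\widetilde\alpha}$ with $\alpha(s,w)=\alpha$. -}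

module Defs where

open import Data.Bool using (Bool; true; false; _∧_; _∨_; not; if_then_else_)
open import Data.Nat using (ℕ; zero; suc; _∸_; _≤_; _≤ᵇ_; _<ᵇ_; _≡ᵇ_)
open import Data.Integer using (ℤ; +_; -_) renaming (_+_ to _+ℤ_; _*_ to _*ℤ_; _^_ to _^ℤ_)
open import Data.List using (List; []; _∷_; map; concatMap; length; reverse; filter; upTo; zip; replicate)
open import Data.Nat.ListAction using (sum)
open import Data.List.Relation.Unary.All using (All)
open import Data.Product using (_×_; _,_; proj₁; proj₂)
open import Relation.Binary.PropositionalEquality using (_≡_)
open import Relation.Nullary.Decidable using (does)
open import Relation.Unary using (Pred)

IsComposition : ℕ → List ℕ → Set
IsComposition n α = All (1 ≤_) α × sum α ≡ n

range1 : ℕ → List ℕ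
range1 m = map suc (upTo m)

nth : List ℕ → ℕ → ℕ
nth []       _       = 0
nth (x ∷ xs) zero    = x
nth (x ∷ xs) (suc i) = nth xs i

all : {A : Set} → (A → Bool) → List A → Bool
all P []       = true
all P (x ∷ xs) = P x ∧ all P xs

memᵇ : ℕ → List ℕ → Bool
memᵇ x []       = false
memᵇ x (y ∷ ys) = (x ≡ᵇ y) ∨ memᵇ x ys

listEqᵇ : List ℕ → List ℕ → Bool
listEqᵇ []       []       = true
listEqᵇ (x ∷ xs) (y ∷ ys) = (x ≡ᵇ y) ∧ listEqᵇ xs ys
listEqᵇ _        _        = false

setOf : List ℕ → List ℕ
setOf []           = []
setOf (a ∷ [])     = []
setOf (a ∷ b ∷ bs) = a ∷ map (a Data.Nat.+_) (setOf (b ∷ bs))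

-- comp n S for S = {s₁ < … < s_k} ⊆ [n-1]:  s₁, s₂-s₁, …, n-s_k ;  comp 0 ∅ = empty composition
compAux : ℕ → ℕ → List ℕ → List ℕ
compAux prev n []       = (n ∸ prev) ∷ []
compAux prev n (s ∷ ss) = (s ∸ prev) ∷ compAux s n ss

comp : ℕ → List ℕ → List ℕ
comp zero    _ = []
comp (suc m) S = compAux 0 (suc m) S

rev : List ℕ → List ℕ
rev = reverse

complement : List ℕ → List ℕ
complement α = comp (sum α) (filter (λ j → not (memᵇ j (setOf α)) Data.Bool.≟ true) (range1 (sum α ∸ 1)))

transpose : List ℕ → List ℕ
transpose α = complement (rev α)

compsSuc : ℕ → List (List ℕ)
compsSuc zero    = (1 ∷ []) ∷ []
compsSuc (suc m) = concatMap (λ c → (1 ∷ c) ∷ incHead c ∷ []) (compsSuc m)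
  where
  incHead : List ℕ → List ℕ
  incHead []       = []
  incHead (x ∷ xs) = suc x ∷ xs

comps : ℕ → List (List ℕ)
comps zero    = [] ∷ []
comps (suc m) = compsSuc m

-- Homogeneous formal power series in x₁, x₂, … with ℤ coefficients.
-- A monomial x₁^{e₁} x₂^{e₂} ⋯ x_k^{e_k} is encoded by its exponent list
-- e = e₁ ∷ … ∷ e_k ∷ [] (every monomial is of this form; trailing zeros allowed).
-- A series is its coefficient function.

Monomial : Set
Monomial = List ℕ

Series : Set
Series = Monomial → ℤ

_≈ˢ_ : Series → Series → Set
f ≈ˢ g = ∀ e → f e ≡ g e

infix 4 _≈ˢ_

_·ˢ_ : ℤ → Series → Series
(c ·ˢ f) e = c *ℤ f e

_+ˢ_ : Series → Series → Series
(f +ˢ g) e = f e +ℤ g e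

0ˢ : Series
0ˢ e = + 0

sumˢ : {A : Set} → List A → (A → Series) → Series
sumˢ []       f = 0ˢ
sumˢ (x ∷ xs) f = f x +ˢ sumˢ xs f

-- Fundamental quasisymmetric function F_α.
-- The coefficient of x^e in F_α is the number of sequences i₁ ≤ … ≤ i_n whose
-- monomial x_{i₁}⋯x_{i_n} equals x^e and with i_j < i_{j+1} for j ∈ set(α).
-- There is at most one weakly increasing sequence with given monomial
-- (the sorted word of e), and it exists iff sum e = n.

sortedWord : Monomial → List ℕ
sortedWord e = go 1 e
  where
  go : ℕ → List ℕ → List ℕ
  go j []       = []
  go j (k ∷ ks) = replicate k j Data.List.++ go (suc j) ks

boolToℤ : Bool → ℤ
boolToℤ true  = + 1
boolToℤ false = + 0

F : List ℕ → Series
F α e = boolToℤ ((sum e ≡ᵇ sum α) ∧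
                 all (λ j → nth (sortedWord e) (j ∸ 1) <ᵇ nth (sortedWord e) j) (setOf α))

-- The antichain P^{α̃}: elements a_k (1 ≤ a, 1 ≤ k ≤ r_a = multiplicity of a in α),
-- encoded as pairs (a , k); weight w(a_k) = a.

Elem : Set
Elem = ℕ × ℕ

w : Elem → ℕ
w = proj₁

count : ℕ → List ℕ → ℕ
count a α = length (filter (λ x → x Data.Nat.≟ a) α)

elemsP : List ℕ → List Elem
elemsP α = concatMap (λ a → map (a ,_) (range1 (count a α))) (range1 (sum α))

_<ℕℕ_ : Elem → Elem → Bool
(a , k) <ℕℕ (b , l) = (a <ᵇ b) ∨ ((a ≡ᵇ b) ∧ (k <ᵇ l))

-- labellings:  γ into ℕ_ℕ^* (reversed order),  γ* into ℕ_ℕ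
γ-lt : Elem → Elem → Bool
γ-lt p q = q <ℕℕ p

γ*-lt : Elem → Elem → Bool
γ*-lt p q = p <ℕℕ q

-- all orderings of a list (the linear extensions of an antichain on those elements)
insertions : {A : Set} → A → List A → List (List A)
insertions x []       = (x ∷ []) ∷ []
insertions x (y ∷ ys) = (x ∷ y ∷ ys) ∷ map (y ∷_) (insertions x ys)

perms : {A : Set} → List A → List (List A)
perms []       = [] ∷ []
perms (x ∷ xs) = concatMap (insertions x) (perms xs)

linExts : List ℕ → List (List Elem)
linExts α = perms (elemsP α)

-- K_{(s,γ,w)} for a chain s = u₁ < … < u_ℓ (given as the list of its elements in order)
-- with labelling given by its strict order `lt`.
-- A map f : s → ℕ is a list of values (f(u₁), …, f(u_ℓ)).

isPartitionᵇ : (Elem → Elem → Bool) → List Elem → List ℕ → Bool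
isPartitionᵇ lt (u ∷ us) (x ∷ xs) =
  all (λ vy → (x ≤ᵇ proj₂ vy) ∧ (not (x ≡ᵇ proj₂ vy) ∨ lt u (proj₁ vy))) (zip us xs)
  ∧ isPartitionᵇ lt us xs
isPartitionᵇ lt _ _ = true

allMaps : ℕ → ℕ → List (List ℕ)
allMaps zero    L = [] ∷ []
allMaps (suc ℓ) L = concatMap (λ x → map (x ∷_) (allMaps ℓ L)) (range1 L)

expAt : List Elem → List ℕ → ℕ → ℕ
expAt (u ∷ us) (x ∷ xs) j = (if x ≡ᵇ j then w u else 0) Data.Nat.+ expAt us xs j
expAt _ _ j = 0

-- ∏_u x_{f(u)}^{w(u)} = x^e  (with e = e₁ … e_L; all weights are positive,
-- so f necessarily takes values in {1,…,L})
monomialIsᵇ : List Elem → List ℕ → Monomial → Bool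
monomialIsᵇ s f e = all (λ j → expAt s f j ≡ᵇ nth e (j ∸ 1)) (range1 (length e))

K-chain : (Elem → Elem → Bool) → List Elem → Series
K-chain lt s e =
  + length (filter (λ f → (isPartitionᵇ lt s f ∧ monomialIsᵇ s f e) Data.Bool.≟ true)
                   (allMaps (length s) (length e)))

p : List ℕ → Series
p α = sumˢ (filter (λ s → listEqᵇ (map w s) α Data.Bool.≟ true) (linExts α)) (K-chain γ-lt)

pʳ : List ℕ → Series
pʳ α = sumˢ (filter (λ s → listEqᵇ (map w s) α Data.Bool.≟ true) (linExts α)) (K-chain γ*-lt)

-- Linear maps ψ, ρ, ω applied to an F-expansion Σ_{β ⊨ n} c_β F_β

F-expansion : ℕ → (List ℕ → ℤ) → Series
F-expansion n c = sumˢ (comps n) (λ β → c β ·ˢ F β)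

ψ-expansion : ℕ → (List ℕ → ℤ) → Series
ψ-expansion n c = sumˢ (comps n) (λ β → c β ·ˢ F (complement β))

ρ-expansion : ℕ → (List ℕ → ℤ) → Series
ρ-expansion n c = sumˢ (comps n) (λ β → c β ·ˢ F (rev β))

ω-expansion : ℕ → (List ℕ → ℤ) → Series
ω-expansion n c = sumˢ (comps n) (λ β → c β ·ˢ F (transpose β))

sign : ℕ → ℤ
sign k = (- (+ 1)) ^ℤ k

{-# OPTIONS --safe #-}

-- A sequence i₁ ≤ … ≤ iₙ is determined by its monomial, and whether a chain's
-- (P,γ)-partition or a fundamental quasisymmetric function contributes to that monomial
-- depends only on the bits (i_j < i_{j+1}). Such a condition is a word in the relations
-- ≤, <, = on consecutive indices: F_α has < at the elements of set(α) and ≤ elsewhere,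
-- while K_{(s,γ,w)} has a block of w(u) - 1 letters = for each u, and ≤ or < between
-- blocks according to the labels. As functions of one bit, (=) is (≤) - (<), so ψ, which
-- exchanges ≤ and <, sends = to its negative: K_{(s,γ,w)} goes to
-- (-1)^(n-ℓ) K_{(s,γ*,w)} for each linear extension s separately. In the same way ρ
-- reverses words, hence chains, and ω is the composite of the two. Realising ψ and ρ as
-- operators on functions of the bits makes the result independent of the chosen
-- expansion of p_α, so no linear independence of the F_α is needed.
module Submission where

open import Defs
open import Data.Bool using (Bool; true; false; _∧_; _∨_; not; if_then_else_)
import Data.Bool as Bool
import Data.Bool.Properties as Bool
open import Data.Empty using (⊥-elim)
open import Data.Nat as ℕ using (ℕ; zero; suc; pred; _+_; _∸_; _≤_; _<_; z≤n; s≤s; _≡ᵇ_; _<ᵇ_; _≤ᵇ_)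
import Data.Nat.Properties as ℕ
open import Data.Nat.ListAction using (sum)
open import Data.Nat.ListAction.Properties using (sum-↭)
open import Data.Integer using (ℤ; +_; -_) renaming (_+_ to _+ℤ_; _*_ to _*ℤ_; _-_ to _-ℤ_)
import Data.Integer.Properties as ℤ
open import Data.Integer.Tactic.RingSolver using (solve-∀)
open import Data.List using (List; []; _∷_; _++_; _∷ʳ_; map; concatMap; length; reverse; filter; upTo; applyUpTo; zip; replicate)
open import Data.List.Properties
open import Data.List.Relation.Binary.Permutation.Propositional as ↭ using (_↭_; ↭⇒↭ₛ)
import Data.List.Relation.Binary.Permutation.Propositional.Properties as ↭
import Data.List.Relation.Binary.Permutation.Setoid.Properties as ↭ₛ
open import Data.List.Relation.Unary.All as All using (All; []; _∷_)
import Data.List.Relation.Unary.All.Properties as All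
open import Data.List.Relation.Unary.AllPairs as AllPairs using (AllPairs; []; _∷_)
import Data.List.Relation.Unary.AllPairs.Properties as AllPairs
open import Data.List.Relation.Unary.Unique.Propositional using (Unique)
import Data.List.Relation.Unary.Unique.Propositional.Properties as Unique
open import Data.Product using (Σ; _×_; _,_; proj₁; proj₂)
open import Data.Sum using (inj₁; inj₂)
open import Function using (_∘_; id; flip)
open import Relation.Binary.Definitions using (tri<; tri≈; tri>)
open import Relation.Binary.PropositionalEquality

-- Finite sums of integers

∑ : {A : Set} → List A → (A → ℤ) → ℤ
∑ []       f = + 0
∑ (x ∷ xs) f = f x +ℤ ∑ xs f

sumˢ-∑ : {A : Set} (xs : List A) (f : A → Series) (e : Monomial) → sumˢ xs f e ≡ ∑ xs (λ x → f x e)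
sumˢ-∑ []       f e = refl
sumˢ-∑ (x ∷ xs) f e = cong (f x e +ℤ_) (sumˢ-∑ xs f e)

∑-cong-All : {A : Set} {f g : A → ℤ} {xs : List A} → All (λ x → f x ≡ g x) xs → ∑ xs f ≡ ∑ xs g
∑-cong-All []       = refl
∑-cong-All (p ∷ ps) = cong₂ _+ℤ_ p (∑-cong-All ps)

∑-cong : {A : Set} {f g : A → ℤ} (xs : List A) → (∀ x → f x ≡ g x) → ∑ xs f ≡ ∑ xs g
∑-cong xs p = ∑-cong-All (All.universal p xs)

∑-*ˡ : {A : Set} (k : ℤ) (xs : List A) (f : A → ℤ) → ∑ xs (λ x → k *ℤ f x) ≡ k *ℤ ∑ xs f
∑-*ˡ k []       f = sym (ℤ.*-zeroʳ k)
∑-*ˡ k (x ∷ xs) f = trans (cong (k *ℤ f x +ℤ_) (∑-*ˡ k xs f)) (sym (ℤ.*-distribˡ-+ k _ _))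

∑-+ : {A : Set} (xs : List A) (f g : A → ℤ) → ∑ xs (λ x → f x +ℤ g x) ≡ ∑ xs f +ℤ ∑ xs g
∑-+ []       f g = refl
∑-+ (x ∷ xs) f g = trans (cong (f x +ℤ g x +ℤ_) (∑-+ xs f g)) (interchange (f x) (g x) (∑ xs f) (∑ xs g))
  where
  interchange : ∀ a b c d → (a +ℤ b) +ℤ (c +ℤ d) ≡ (a +ℤ c) +ℤ (b +ℤ d)
  interchange = solve-∀

∑-minus : {A : Set} (xs : List A) (f g : A → ℤ) → ∑ xs (λ x → f x -ℤ g x) ≡ ∑ xs f -ℤ ∑ xs g
∑-minus []       f g = refl
∑-minus (x ∷ xs) f g = trans (cong (f x -ℤ g x +ℤ_) (∑-minus xs f g)) (interchange (f x) (g x) (∑ xs f) (∑ xs g))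
  where
  interchange : ∀ a b c d → (a -ℤ b) +ℤ (c -ℤ d) ≡ (a +ℤ c) -ℤ (b +ℤ d)
  interchange = solve-∀

∑-map : {A B : Set} (g : A → B) (xs : List A) (f : B → ℤ) → ∑ (map g xs) f ≡ ∑ xs (f ∘ g)
∑-map g []       f = refl
∑-map g (x ∷ xs) f = cong (f (g x) +ℤ_) (∑-map g xs f)

∑-++ : {A : Set} (xs ys : List A) (f : A → ℤ) → ∑ (xs ++ ys) f ≡ ∑ xs f +ℤ ∑ ys f
∑-++ []       ys f = sym (ℤ.+-identityˡ _)
∑-++ (x ∷ xs) ys f = trans (cong (f x +ℤ_) (∑-++ xs ys f)) (sym (ℤ.+-assoc (f x) _ _))

∑-concatMap : {A B : Set} (g : A → List B) (xs : List A) (f : B → ℤ) →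
  ∑ (concatMap g xs) f ≡ ∑ xs (λ x → ∑ (g x) f)
∑-concatMap g []       f = refl
∑-concatMap g (x ∷ xs) f = trans (∑-++ (g x) _ f) (cong (∑ (g x) f +ℤ_) (∑-concatMap g xs f))

∑-filter : {A : Set} (q : A → Bool) (xs : List A) (f : A → ℤ) →
  ∑ (filter (λ x → q x Bool.≟ true) xs) f ≡ ∑ xs (λ x → if q x then f x else + 0)
∑-filter q []       f = refl
∑-filter q (x ∷ xs) f with q x
... | true  = cong (f x +ℤ_) (∑-filter q xs f)
... | false = trans (∑-filter q xs f) (sym (ℤ.+-identityˡ _))

-- Gap words and ascents

-- A gap word of length n ∸ 1 prescribes, for a sequence i₁ ≤ … ≤ iₙ, the relation
-- between each i_j and i_{j+1}.
data Gap : Set where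
  weak strict equal : Gap

allows : Gap → Bool → Bool
allows weak   _ = true
allows strict t = t
allows equal  t = not t

-- Bit j of T records whether i_j < i_{j+1}.
compat : List Gap → List Bool → Bool
compat []       []       = true
compat (g ∷ gs) (t ∷ ts) = allows g t ∧ compat gs ts
compat _        _        = false

⟦_⟧ : List Gap → List Bool → ℤ
⟦ gs ⟧ T = boolToℤ (compat gs T)

ascents : List ℕ → List Bool
ascents []           = []
ascents (x ∷ [])     = []
ascents (x ∷ y ∷ ys) = (x <ᵇ y) ∷ ascents (y ∷ ys)

length-ascents : ∀ xs → length (ascents xs) ≡ pred (length xs)
length-ascents []           = refl
length-ascents (x ∷ [])     = refl
length-ascents (x ∷ y ∷ ys) = cong suc (length-ascents (y ∷ ys))

-- Dual gap words and the operator for ψ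

dual : Gap → Gap
dual weak   = strict
dual strict = weak
dual equal  = equal

fromBit : Bool → Gap
fromBit true  = strict
fromBit false = weak

dual-fromBit : ∀ b → fromBit (not b) ≡ dual (fromBit b)
dual-fromBit true  = refl
dual-fromBit false = refl

-- ψ exchanges the indicators (1,1) of ≤ and (0,1) of <, so on each bit it is
-- (g₀ , g₁) ↦ (g₁ - g₀ , g₁).
Ψ : (List Bool → ℤ) → List Bool → ℤ
Ψ φ []          = φ []
Ψ φ (true  ∷ T) = Ψ (λ U → φ (true ∷ U)) T
Ψ φ (false ∷ T) = Ψ (λ U → φ (true ∷ U)) T -ℤ Ψ (λ U → φ (false ∷ U)) T

-- `Ψ` evaluates its argument only at words as long as `T`. This locality matters because functions
-- attached to series of degree n are compared only on words of length n - 1.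
Ψ-cong : ∀ {φ χ} T → (∀ U → length U ≡ length T → φ U ≡ χ U) → Ψ φ T ≡ Ψ χ T
Ψ-cong []          p = p [] refl
Ψ-cong (true  ∷ T) p = Ψ-cong T (λ U l → p (true ∷ U) (cong suc l))
Ψ-cong (false ∷ T) p = cong₂ _-ℤ_ (Ψ-cong T (λ U l → p (true ∷ U) (cong suc l)))
                                  (Ψ-cong T (λ U l → p (false ∷ U) (cong suc l)))

Ψ-∑ : {A : Set} (xs : List A) (f : A → List Bool → ℤ) (T : List Bool) →
  Ψ (λ U → ∑ xs (λ x → f x U)) T ≡ ∑ xs (λ x → Ψ (f x) T)
Ψ-∑ xs f []          = refl
Ψ-∑ xs f (true  ∷ T) = Ψ-∑ xs (λ x U → f x (true ∷ U)) T
Ψ-∑ xs f (false ∷ T) = trans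
  (cong₂ _-ℤ_ (Ψ-∑ xs (λ x U → f x (true ∷ U)) T) (Ψ-∑ xs (λ x U → f x (false ∷ U)) T))
  (sym (∑-minus xs _ _))

Ψ-*ˡ : ∀ k φ T → Ψ (λ U → k *ℤ φ U) T ≡ k *ℤ Ψ φ T
Ψ-*ˡ k φ []          = refl
Ψ-*ˡ k φ (true  ∷ T) = Ψ-*ˡ k _ T
Ψ-*ˡ k φ (false ∷ T) = trans (cong₂ _-ℤ_ (Ψ-*ˡ k _ T) (Ψ-*ˡ k _ T)) (sym (distrib k _ _))
  where
  distrib : ∀ k a b → k *ℤ (a -ℤ b) ≡ k *ℤ a -ℤ k *ℤ b
  distrib = solve-∀

Ψ-0 : ∀ T → Ψ (λ _ → + 0) T ≡ + 0
Ψ-0 []          = refl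
Ψ-0 (true  ∷ T) = Ψ-0 T
Ψ-0 (false ∷ T) = cong₂ _-ℤ_ (Ψ-0 T) (Ψ-0 T)

equals : List Gap → ℕ
equals []            = 0
equals (weak   ∷ gs) = equals gs
equals (strict ∷ gs) = equals gs
equals (equal  ∷ gs) = suc (equals gs)

-- As pairs of values at `false` and `true`, ≤ = (1,1) goes to (0,1), < = (0,1) goes to (1,1), and =
-- is (1,0), which goes to (-1,0). So each letter is dualised and every = contributes a factor -1.
-- If the lengths differ, both sides vanish.
Ψ-⟦⟧ : ∀ gs T → Ψ ⟦ gs ⟧ T ≡ sign (equals gs) *ℤ ⟦ map dual gs ⟧ T
Ψ-⟦⟧ []       []          = refl
Ψ-⟦⟧ []       (true  ∷ T) = Ψ-0 T
Ψ-⟦⟧ []       (false ∷ T) = cong₂ _-ℤ_ (Ψ-0 T) (Ψ-0 T)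
Ψ-⟦⟧ (g ∷ gs) []          = sym (ℤ.*-zeroʳ (sign (equals (g ∷ gs))))
Ψ-⟦⟧ (weak ∷ gs)   (true  ∷ T) = Ψ-⟦⟧ gs T
Ψ-⟦⟧ (strict ∷ gs) (true  ∷ T) = Ψ-⟦⟧ gs T
Ψ-⟦⟧ (equal ∷ gs)  (true  ∷ T) = trans (Ψ-0 T) (sym (ℤ.*-zeroʳ (sign (equals (equal ∷ gs)))))
Ψ-⟦⟧ (weak ∷ gs)   (false ∷ T) =
  trans (ℤ.+-inverseʳ (Ψ ⟦ gs ⟧ T)) (sym (ℤ.*-zeroʳ (sign (equals gs))))
Ψ-⟦⟧ (strict ∷ gs) (false ∷ T) =
  trans (cong₂ _-ℤ_ (Ψ-⟦⟧ gs T) (Ψ-0 T)) (ℤ.+-identityʳ _)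
Ψ-⟦⟧ (equal ∷ gs)  (false ∷ T) =
  trans (cong₂ _-ℤ_ (Ψ-0 T) (Ψ-⟦⟧ gs T)) (negate (sign (equals gs)) (⟦ map dual gs ⟧ T))
  where
  negate : ∀ a b → + 0 -ℤ a *ℤ b ≡ (- (+ 1)) *ℤ a *ℤ b
  negate = solve-∀

-- Reversal of gap words

∧-swap : ∀ a b c → a ∧ (b ∧ c) ≡ b ∧ (a ∧ c)
∧-swap true  _     _ = refl
∧-swap false true  _ = refl
∧-swap false false _ = refl

compat-∷ʳ : ∀ gs g T t → compat (gs ∷ʳ g) (T ∷ʳ t) ≡ allows g t ∧ compat gs T
compat-∷ʳ []           g []          t = refl
-- In this and the next three clauses the lengths differ, and each side is a conjunction with
-- `false`.
compat-∷ʳ []           g (u ∷ [])    t = trans (Bool.∧-zeroʳ (allows g u)) (sym (Bool.∧-zeroʳ (allows g t)))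
compat-∷ʳ []           g (u ∷ _ ∷ _) t = trans (Bool.∧-zeroʳ (allows g u)) (sym (Bool.∧-zeroʳ (allows g t)))
compat-∷ʳ (h ∷ [])     g []          t = trans (Bool.∧-zeroʳ (allows h t)) (sym (Bool.∧-zeroʳ (allows g t)))
compat-∷ʳ (h ∷ _ ∷ _)  g []          t = trans (Bool.∧-zeroʳ (allows h t)) (sym (Bool.∧-zeroʳ (allows g t)))
compat-∷ʳ (h ∷ gs)     g (u ∷ T)     t =
  trans (cong (allows h u ∧_) (compat-∷ʳ gs g T t)) (∧-swap (allows h u) (allows g t) (compat gs T))

compat-reverse : ∀ gs T → compat (reverse gs) (reverse T) ≡ compat gs T
compat-reverse [] [] = refl
compat-reverse [] (t ∷ T) rewrite unfold-reverse t T with reverse T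
... | []    = refl
... | _ ∷ _ = refl
compat-reverse (g ∷ gs) [] rewrite unfold-reverse g gs with reverse gs
... | []    = refl
... | _ ∷ _ = refl
compat-reverse (g ∷ gs) (t ∷ T) rewrite unfold-reverse g gs | unfold-reverse t T =
  trans (compat-∷ʳ (reverse gs) g (reverse T) t) (cong (allows g t ∧_) (compat-reverse gs T))

⟦⟧-reverse : ∀ gs T → ⟦ reverse gs ⟧ T ≡ ⟦ gs ⟧ (reverse T)
⟦⟧-reverse gs T = cong boolToℤ (trans (cong (compat (reverse gs)) (sym (reverse-involutive T)))
                                      (compat-reverse gs (reverse T)))

-- Expansion into indicators of fundamental functions

bits : ℕ → List (List Bool)
bits zero    = [] ∷ []
bits (suc m) = concatMap (λ b → (true ∷ b) ∷ (false ∷ b) ∷ []) (bits m)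

bits-length : ∀ m → All (λ b → length b ≡ m) (bits m)
bits-length zero    = refl ∷ []
bits-length (suc m) = All.concat⁺ (All.map⁺ (All.map (λ l → cong suc l ∷ cong suc l ∷ []) (bits-length m)))

-- The bit condition of the fundamental quasisymmetric function whose descent set has indicator `b`;
-- `F-κ` makes the link.
⟨_⟩ : List Bool → List Bool → ℤ
⟨ b ⟩ = ⟦ map fromBit b ⟧

∑-bits : ∀ m (f : List Bool → ℤ) →
  ∑ (bits (suc m)) f ≡ ∑ (bits m) (f ∘ (true ∷_)) +ℤ ∑ (bits m) (f ∘ (false ∷_))
∑-bits m f = trans (∑-concatMap _ (bits m) f)
  (trans (∑-cong (bits m) (λ b → cong (f (true ∷ b) +ℤ_) (ℤ.+-identityʳ _))) (∑-+ (bits m) _ _))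

-- Since (g₀ , g₁) = g₀ (1,1) + (g₁ - g₀) (0,1), this is the expansion of φ into
-- the functions ⟨ b ⟩.
coeff : (List Bool → ℤ) → List Bool → ℤ
coeff φ []          = φ []
coeff φ (false ∷ b) = coeff (λ U → φ (false ∷ U)) b
coeff φ (true  ∷ b) = coeff (λ U → φ (true ∷ U) -ℤ φ (false ∷ U)) b

-- At a leading bit `true` both ≤ and < accept, and the coefficients add up to (g₁ - g₀) + g₀ = g₁.
-- At `false` the words starting with < drop out and g₀ remains.
∑-coeff : ∀ m φ T → length T ≡ m → ∑ (bits m) (λ b → coeff φ b *ℤ ⟨ b ⟩ T) ≡ φ T
∑-coeff zero    φ []      refl = trans (ℤ.+-identityʳ _) (ℤ.*-identityʳ _)
∑-coeff (suc m) φ (t ∷ T) l    = trans (∑-bits m _) (split t)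
  where
  ih : ∀ χ → ∑ (bits m) (λ b → coeff χ b *ℤ ⟨ b ⟩ T) ≡ χ T
  ih χ = ∑-coeff m χ T (ℕ.suc-injective l)
  cancel : ∀ a b → (a -ℤ b) +ℤ b ≡ a
  cancel = solve-∀
  split : ∀ t → ∑ (bits m) (λ b → coeff φ (true ∷ b) *ℤ ⟨ true ∷ b ⟩ (t ∷ T))
             +ℤ ∑ (bits m) (λ b → coeff φ (false ∷ b) *ℤ ⟨ false ∷ b ⟩ (t ∷ T)) ≡ φ (t ∷ T)
  split true  = trans (cong₂ _+ℤ_ (ih _) (ih _)) (cancel (φ (true ∷ T)) (φ (false ∷ T)))
  split false = trans (cong₂ _+ℤ_ (∑-*ˡ-0 (bits m)) (ih _)) (ℤ.+-identityˡ _)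
    where
    ∑-*ˡ-0 : ∀ bs → ∑ bs (λ b → coeff φ (true ∷ b) *ℤ + 0) ≡ + 0
    ∑-*ˡ-0 []       = refl
    ∑-*ˡ-0 (b ∷ bs) = cong₂ _+ℤ_ (ℤ.*-zeroʳ (coeff φ (true ∷ b))) (∑-*ˡ-0 bs)

-- Sorted words and compositions

sortedWordFrom : ℕ → List ℕ → List ℕ
sortedWordFrom j []       = []
sortedWordFrom j (k ∷ ks) = replicate k j ++ sortedWordFrom (suc j) ks

-- Formulated for any `g` satisfying the two recursion equations, so that it applies to the local
-- function inside `sortedWord`.
sortedWordFrom-unique : (g : ℕ → List ℕ → List ℕ) → (∀ j → g j [] ≡ []) →
  (∀ j k ks → g j (k ∷ ks) ≡ replicate k j ++ g (suc j) ks) → ∀ j e → g j e ≡ sortedWordFrom j e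
sortedWordFrom-unique g p q j []       = p j
sortedWordFrom-unique g p q j (k ∷ ks) =
  trans (q j k ks) (cong (replicate k j ++_) (sortedWordFrom-unique g p q (suc j) ks))

-- Unification fills in go with the local function of sortedWord, which has no name in scope;
-- abstracting from k ∷ ks and 2 makes this a pattern unification problem.
mutual
  go : List ℕ → ℕ → List ℕ → List ℕ
  go = _

  sortedWord-From : ∀ e → sortedWord e ≡ sortedWordFrom 1 e
  sortedWord-From [] = refl
  sortedWord-From (k ∷ ks) with k ∷ ks | 2
  ... | e | j = cong (replicate k 1 ++_)
    (sortedWordFrom-unique (go e) (λ _ → refl) (λ _ _ _ → refl) j ks)

length-sortedWordFrom : ∀ j e → length (sortedWordFrom j e) ≡ sum e
length-sortedWordFrom j []       = refl
length-sortedWordFrom j (k ∷ ks) = trans (length-++ (replicate k j))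
  (cong₂ _+_ (length-replicate k) (length-sortedWordFrom (suc j) ks))

length-sortedWord : ∀ e → length (sortedWord e) ≡ sum e
length-sortedWord e = trans (cong length (sortedWord-From e)) (length-sortedWordFrom 1 e)

gaps : Monomial → List Bool
gaps e = ascents (sortedWord e)

length-gaps : ∀ e → length (gaps e) ≡ pred (sum e)
length-gaps e = trans (length-ascents (sortedWord e)) (cong pred (length-sortedWord e))

incHead : List ℕ → List ℕ
incHead []       = []
incHead (x ∷ xs) = suc x ∷ xs

incLast : List ℕ → List ℕ
incLast []           = []
incLast (x ∷ [])     = suc x ∷ []
incLast (x ∷ y ∷ ys) = x ∷ incLast (y ∷ ys)

-- The composition of 1 + length b whose set of partial sums has indicator b.
compOf : List Bool → List ℕ
compOf []          = 1 ∷ []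
compOf (true  ∷ b) = 1 ∷ compOf b
compOf (false ∷ b) = incHead (compOf b)

-- Degrees 0 and 1 share the single bit word `[]`, because `pred 0` is 0; in degree 0 it has to name
-- the empty composition instead of the composition 1.
κ : ℕ → List Bool → List ℕ
κ zero    b = []
κ (suc m) b = compOf b

data NonEmpty {A : Set} : List A → Set where
  cons : ∀ x xs → NonEmpty (x ∷ xs)

compOf-nonEmpty : ∀ b → NonEmpty (compOf b)
compOf-nonEmpty []          = cons 1 []
compOf-nonEmpty (true  ∷ b) = cons 1 (compOf b)
compOf-nonEmpty (false ∷ b) with compOf b | compOf-nonEmpty b
... | _ | cons x xs = cons (suc x) xs

compsSuc-compOf : ∀ m → compsSuc m ≡ map compOf (bits m)
compsSuc-compOf zero    = refl
compsSuc-compOf (suc m) =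
  -- The function that `compsSuc` applies to the head is local to it; here it is exchanged for the
  -- top-level `incHead`, with which it agrees on each constructor.
  trans (congConcat _ incHead (λ { [] → refl ; (_ ∷ _) → refl }) (compsSuc m))
    (trans (cong (concatMap _) (compsSuc-compOf m)) (mapConcat (bits m)))
  where
  congConcat : (g h : List ℕ → List ℕ) → (∀ c → g c ≡ h c) → ∀ cs →
    concatMap (λ c → (1 ∷ c) ∷ g c ∷ []) cs ≡ concatMap (λ c → (1 ∷ c) ∷ h c ∷ []) cs
  congConcat g h p []       = refl
  congConcat g h p (c ∷ cs) = cong₂ (λ d ds → (1 ∷ c) ∷ d ∷ ds) (p c) (congConcat g h p cs)
  mapConcat : ∀ bs → concatMap (λ c → (1 ∷ c) ∷ incHead c ∷ []) (map compOf bs)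
                   ≡ map compOf (concatMap (λ b → (true ∷ b) ∷ (false ∷ b) ∷ []) bs)
  mapConcat []       = refl
  mapConcat (b ∷ bs) = cong (λ ds → (1 ∷ compOf b) ∷ incHead (compOf b) ∷ ds) (mapConcat bs)

comps-κ : ∀ n → comps n ≡ map (κ n) (bits (pred n))
comps-κ zero    = refl
comps-κ (suc m) = compsSuc-compOf m

sum-incHead : ∀ {c} → NonEmpty c → sum (incHead c) ≡ suc (sum c)
sum-incHead (cons _ _) = refl

sum-compOf : ∀ b → sum (compOf b) ≡ suc (length b)
sum-compOf []          = refl
sum-compOf (true  ∷ b) = cong suc (sum-compOf b)
sum-compOf (false ∷ b) = trans (sum-incHead (compOf-nonEmpty b)) (cong suc (sum-compOf b))

sum-κ : ∀ n b → length b ≡ pred n → sum (κ n b) ≡ n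
sum-κ zero    b l = refl
sum-κ (suc m) b l = trans (sum-compOf b) (cong suc l)

<ᵇ-irrefl : ∀ n → (n <ᵇ n) ≡ false
<ᵇ-irrefl zero    = refl
<ᵇ-irrefl (suc n) = <ᵇ-irrefl n

-- Read as an exponent list, a composition has a sorted word that repeats each successive letter as
-- often as the part says, so it rises exactly at the partial sums. The first letter `j` is exposed
-- so that the next comparison can be computed.
ascents-compOf : ∀ b j → Σ (List ℕ) λ W → sortedWordFrom j (compOf b) ≡ j ∷ W × ascents (j ∷ W) ≡ b
ascents-compOf []         j = [] , refl , refl
ascents-compOf (true ∷ b) j with ascents-compOf b (suc j)
... | W , p , q = suc j ∷ W , cong (j ∷_) p , cong₂ _∷_ (<ᵇ-suc j) q
  where
  <ᵇ-suc : ∀ j → (j <ᵇ suc j) ≡ true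
  <ᵇ-suc zero    = refl
  <ᵇ-suc (suc j) = <ᵇ-suc j
ascents-compOf (false ∷ b) j with compOf b | compOf-nonEmpty b | ascents-compOf b j
... | _ | cons x xs | W , p , q = j ∷ W , cong (j ∷_) p , cong₂ _∷_ (<ᵇ-irrefl j) q

-- Every bit word is realised by a monomial, namely by its own composition used as exponents. This
-- supplies test monomials for comparing functions of bits.
gaps-κ : ∀ n b → length b ≡ pred n → gaps (κ n b) ≡ b
gaps-κ zero    [] l = refl
gaps-κ (suc m) b  l with ascents-compOf b 1
... | W , p , q = trans (cong ascents (trans (sortedWord-From (compOf b)) p)) q

-- Indices count from 0, while the elements of set(α) count from 1; hence the shift by `suc` in
-- `setOf-compOf`.
positions : List Bool → List ℕ
positions []          = []
positions (true  ∷ b) = 0 ∷ map suc (positions b)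
positions (false ∷ b) = map suc (positions b)

setOf-incHead : ∀ {c} → NonEmpty c → setOf (incHead c) ≡ map suc (setOf c)
setOf-incHead (cons a [])       = refl
setOf-incHead (cons a (b ∷ bs)) = cong (suc a ∷_) (map-∘ (setOf (b ∷ bs)))

setOf-compOf : ∀ b → setOf (compOf b) ≡ map suc (positions b)
setOf-compOf []         = refl
setOf-compOf (true ∷ b) with compOf b | compOf-nonEmpty b | setOf-compOf b
... | _ | cons x xs | ih = cong (λ ps → 1 ∷ map suc ps) ih
setOf-compOf (false ∷ b) = trans (setOf-incHead (compOf-nonEmpty b)) (cong (map suc) (setOf-compOf b))

all-map : {A B : Set} (q : B → Bool) (f : A → B) (xs : List A) → all q (map f xs) ≡ all (q ∘ f) xs
all-map q f []       = refl
all-map q f (x ∷ xs) = cong (q (f x) ∧_) (all-map q f xs)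

all-strict : ∀ b xs → length xs ≡ suc (length b) →
  all (λ i → nth xs i <ᵇ nth xs (suc i)) (positions b) ≡ compat (map fromBit b) (ascents xs)
all-strict []          (x ∷ [])     l = refl
all-strict (true  ∷ b) (x ∷ y ∷ ys) l = cong ((x <ᵇ y) ∧_)
  (trans (all-map _ suc (positions b)) (all-strict b (y ∷ ys) (ℕ.suc-injective l)))
all-strict (false ∷ b) (x ∷ y ∷ ys) l =
  trans (all-map _ suc (positions b)) (all-strict b (y ∷ ys) (ℕ.suc-injective l))

≡ᵇ-true⇒≡ : ∀ {m n} → (m ≡ᵇ n) ≡ true → m ≡ n
≡ᵇ-true⇒≡ {m} {n} p = ℕ.≡ᵇ⇒≡ m n (subst Bool.T (sym p) _)

≡ᵇ-refl : ∀ n → (n ≡ᵇ n) ≡ true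
≡ᵇ-refl zero    = refl
≡ᵇ-refl (suc n) = ≡ᵇ-refl n

∧-cong-if : ∀ {a b c} → (a ≡ true → b ≡ c) → a ∧ b ≡ a ∧ c
∧-cong-if {true}  p = p refl
∧-cong-if {false} p = refl

-- Separates the degree from the dependence on bits. The sorted word is known to have n letters only
-- when the degree test succeeds, so the bit conditions are compared under that test; otherwise both
-- sides are 0.
F-κ : ∀ n b e → length b ≡ pred n → F (κ n b) e ≡ boolToℤ (sum e ≡ᵇ n) *ℤ ⟨ b ⟩ (gaps e)
F-κ n b e l = trans (cong boolToℤ (trans
  (cong (λ k → (sum e ≡ᵇ k) ∧ all _ (setOf (κ n b))) (sum-κ n b l))
  (∧-cong-if (λ d → strict-κ n b l (trans (length-sortedWord e) (≡ᵇ-true⇒≡ d))))))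
  (boolToℤ-∧ (sum e ≡ᵇ n) _)
  where
  boolToℤ-∧ : ∀ a b → boolToℤ (a ∧ b) ≡ boolToℤ a *ℤ boolToℤ b
  boolToℤ-∧ true  b = sym (ℤ.*-identityˡ (boolToℤ b))
  boolToℤ-∧ false b = refl
  strict-κ : ∀ n b → length b ≡ pred n → length (sortedWord e) ≡ n →
    all (λ j → nth (sortedWord e) (j ∸ 1) <ᵇ nth (sortedWord e) j) (setOf (κ n b))
    ≡ compat (map fromBit b) (gaps e)
  strict-κ zero [] l l′ with sortedWord e
  ... | [] = refl
  strict-κ (suc m) b l l′ =
    trans (cong (all _) (setOf-compOf b))
      (trans (all-map _ suc (positions b))
        (all-strict b (sortedWord e) (trans l′ (cong suc (sym l)))))

-- Complement and reversal of compositions on bit words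

memᵇ-suc : ∀ i ps → memᵇ (suc i) (map suc ps) ≡ memᵇ i ps
memᵇ-suc i []       = refl
memᵇ-suc i (p ∷ ps) = cong ((i ≡ᵇ p) ∨_) (memᵇ-suc i ps)

memᵇ-zero : ∀ ps → memᵇ 0 (map suc ps) ≡ false
memᵇ-zero []       = refl
memᵇ-zero (p ∷ ps) = memᵇ-zero ps

select : (ℕ → Bool) → List ℕ → List ℕ
select q = filter (λ j → q j Bool.≟ true)

select-map-suc : ∀ (q r : ℕ → Bool) xs → (∀ i → q (suc i) ≡ r i) → select q (map suc xs) ≡ map suc (select r xs)
select-map-suc q r []       p = refl
select-map-suc q r (x ∷ xs) p with q (suc x) | r x | p x
... | true  | _ | refl = cong (suc x ∷_) (select-map-suc q r xs p)
... | false | _ | refl = select-map-suc q r xs p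

select-complement : ∀ b → select (λ i → not (memᵇ i (positions b))) (upTo (length b)) ≡ positions (map not b)
select-complement []          = refl
select-complement (true ∷ b)  =
  trans (cong (select _) (sym (map-upTo suc (length b))))
    (trans (select-map-suc _ _ (upTo (length b)) (λ i → cong not (memᵇ-suc i (positions b))))
      (cong (map suc) (select-complement b)))
select-complement (false ∷ b) rewrite memᵇ-zero (positions b) =
  cong (0 ∷_) (trans (cong (select _) (sym (map-upTo suc (length b))))
    (trans (select-map-suc _ _ (upTo (length b)) (λ i → cong not (memᵇ-suc i (positions b))))
      (cong (map suc) (select-complement b))))

compAux-suc : ∀ k n S → compAux (suc k) (suc n) (map suc S) ≡ compAux k n S
compAux-suc k n []       = refl
compAux-suc k n (s ∷ ss) = cong ((s ∸ k) ∷_) (compAux-suc s n ss)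

compAux-incHead : ∀ n S → compAux 0 (suc n) (map suc S) ≡ incHead (compAux 0 n S)
compAux-incHead n []       = refl
compAux-incHead n (s ∷ ss) = cong (suc s ∷_) (compAux-suc s n ss)

compAux-positions : ∀ b → compAux 0 (suc (length b)) (map suc (positions b)) ≡ compOf b
compAux-positions []          = refl
compAux-positions (true ∷ b)  =
  cong (1 ∷_) (trans (compAux-suc 0 (suc (length b)) (map suc (positions b))) (compAux-positions b))
compAux-positions (false ∷ b) =
  trans (compAux-incHead (suc (length b)) (map suc (positions b))) (cong incHead (compAux-positions b))

complement-κ : ∀ n b → complement (κ n b) ≡ κ n (map not b)
complement-κ zero    b = refl
complement-κ (suc m) b rewrite sum-compOf b | setOf-compOf b =
  trans (cong (compAux 0 (suc (length b)))
    (trans (select-map-suc _ _ (upTo (length b)) (λ i → cong not (memᵇ-suc i (positions b))))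
      (cong (map suc) (select-complement b))))
    (trans (cong (λ k → compAux 0 (suc k) (map suc (positions (map not b)))) (sym (length-map not b)))
      (compAux-positions (map not b)))

incLast-∷ʳ : ∀ xs x → incLast (xs ∷ʳ x) ≡ xs ∷ʳ suc x
incLast-∷ʳ []           x = refl
incLast-∷ʳ (y ∷ [])     x = refl
incLast-∷ʳ (y ∷ z ∷ zs) x = cong (y ∷_) (incLast-∷ʳ (z ∷ zs) x)

reverse-incHead : ∀ c → reverse (incHead c) ≡ incLast (reverse c)
reverse-incHead []       = refl
reverse-incHead (x ∷ xs) rewrite unfold-reverse (suc x) xs | unfold-reverse x xs =
  sym (incLast-∷ʳ (reverse xs) x)

incHead-incLast : ∀ c → incHead (incLast c) ≡ incLast (incHead c)
incHead-incLast []          = refl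
incHead-incLast (_ ∷ [])    = refl
incHead-incLast (_ ∷ _ ∷ _) = refl

incHead-∷ʳ : ∀ {c} → NonEmpty c → incHead (c ∷ʳ 1) ≡ incHead c ∷ʳ 1
incHead-∷ʳ (cons _ _) = refl

incLast-∷ : ∀ {c} → NonEmpty c → 1 ∷ incLast c ≡ incLast (1 ∷ c)
incLast-∷ (cons _ _) = refl

-- With `compOf-∷ʳ-false` this gives the recursion of `compOf` from the right end, where reversal
-- moves the first bit.
compOf-∷ʳ-true : ∀ b → compOf (b ∷ʳ true) ≡ compOf b ∷ʳ 1
compOf-∷ʳ-true []          = refl
compOf-∷ʳ-true (true ∷ b)  = cong (1 ∷_) (compOf-∷ʳ-true b)
compOf-∷ʳ-true (false ∷ b) = trans (cong incHead (compOf-∷ʳ-true b)) (incHead-∷ʳ (compOf-nonEmpty b))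

compOf-∷ʳ-false : ∀ b → compOf (b ∷ʳ false) ≡ incLast (compOf b)
compOf-∷ʳ-false []          = refl
compOf-∷ʳ-false (true ∷ b)  = trans (cong (1 ∷_) (compOf-∷ʳ-false b)) (incLast-∷ (compOf-nonEmpty b))
compOf-∷ʳ-false (false ∷ b) = trans (cong incHead (compOf-∷ʳ-false b)) (incHead-incLast (compOf b))

rev-compOf : ∀ b → reverse (compOf b) ≡ compOf (reverse b)
rev-compOf []         = refl
rev-compOf (true ∷ b) rewrite unfold-reverse 1 (compOf b) | unfold-reverse true b =
  trans (cong (_∷ʳ 1) (rev-compOf b)) (sym (compOf-∷ʳ-true (reverse b)))
rev-compOf (false ∷ b) rewrite unfold-reverse false b =
  trans (reverse-incHead (compOf b)) (trans (cong incLast (rev-compOf b)) (sym (compOf-∷ʳ-false (reverse b))))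

rev-κ : ∀ n b → rev (κ n b) ≡ κ n (reverse b)
rev-κ zero    b = refl
rev-κ (suc m) b = rev-compOf b

-- Counting maps by their words

tally : {A : Set} → (A → Bool) → List A → ℕ
tally q xs = length (filter (λ x → q x Bool.≟ true) xs)

boolToℕ : Bool → ℕ
boolToℕ true  = 1
boolToℕ false = 0

tally-cong : {A : Set} {q r : A → Bool} {xs : List A} → All (λ x → q x ≡ r x) xs → tally q xs ≡ tally r xs
tally-cong [] = refl
tally-cong {q = q} {r} {x ∷ xs} (p ∷ ps) with q x | r x | p
... | true  | _ | refl = cong suc (tally-cong ps)
... | false | _ | refl = tally-cong ps

tally-false : {A : Set} (xs : List A) → tally (λ _ → false) xs ≡ 0
tally-false []       = refl
tally-false (x ∷ xs) = tally-false xs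

tally-none : {A : Set} {q : A → Bool} {xs : List A} → All (λ x → q x ≡ false) xs → tally q xs ≡ 0
tally-none {xs = xs} ps = trans (tally-cong ps) (tally-false xs)

tally-∧ : {A : Set} (a : Bool) (q : A → Bool) (xs : List A) {c : Bool} →
  tally q xs ≡ boolToℕ c → tally (λ x → a ∧ q x) xs ≡ boolToℕ (a ∧ c)
tally-∧ true  q xs p = p
tally-∧ false q xs p = tally-false xs

tally-++ : {A : Set} (q : A → Bool) (xs ys : List A) → tally q (xs ++ ys) ≡ tally q xs + tally q ys
tally-++ q xs ys = trans (cong length (filter-++ _ xs ys)) (length-++ (filter _ xs))

tally-map : {A B : Set} (q : B → Bool) (f : A → B) (xs : List A) → tally q (map f xs) ≡ tally (q ∘ f) xs
tally-map q f []       = refl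
tally-map q f (x ∷ xs) with q (f x)
... | true  = cong suc (tally-map q f xs)
... | false = tally-map q f xs

-- Among the first values 1, ..., L exactly one is `suc y`, and the blocks of all the others
-- contribute nothing.
tally-head : (q : List ℕ → Bool) (L y : ℕ) (fs : List (List ℕ)) → y < L →
  (∀ x f → x ≢ suc y → q (x ∷ f) ≡ false) →
  tally q (concatMap (λ x → map (x ∷_) fs) (range1 L)) ≡ tally (q ∘ (suc y ∷_)) fs
tally-head q L y fs y<L none =
  trans (cong (λ xs → tally q (concatMap _ xs)) (map-upTo suc L)) (go₁ suc ℕ.suc-injective L y<L refl)
  where
  -- The enumeration `suc` is generalised to `f`, since the tail of `applyUpTo f` enumerates
  -- `f ∘ suc`. `go₀` treats a range avoiding `suc y`, `go₁` an injective range that meets it.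
  go₀ : (f : ℕ → ℕ) → ∀ L → (∀ i → f i ≢ suc y) → tally q (concatMap (λ x → map (x ∷_) fs) (applyUpTo f L)) ≡ 0
  go₀ f zero    p = refl
  go₀ f (suc L) p = trans (tally-++ q (map (f 0 ∷_) fs) _)
    (cong₂ _+_ (trans (tally-map q (f 0 ∷_) fs) (tally-none (All.universal (λ g → none (f 0) g (p 0)) fs)))
               (go₀ (f ∘ suc) L (p ∘ suc)))
  go₁ : (f : ℕ → ℕ) → (∀ {i j} → f i ≡ f j → i ≡ j) → ∀ L {i} → i < L → f i ≡ suc y →
    tally q (concatMap (λ x → map (x ∷_) fs) (applyUpTo f L)) ≡ tally (q ∘ (suc y ∷_)) fs
  go₁ f inj (suc L) {zero} i<L eq = trans (tally-++ q (map (f 0 ∷_) fs) _)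
    (trans (cong₂ _+_ (trans (tally-map q (f 0 ∷_) fs) (cong (λ x → tally (q ∘ (x ∷_)) fs) eq))
               (go₀ (f ∘ suc) L (λ j eq′ → ℕ.1+n≢0 (inj (trans eq′ (sym eq))))))
           (ℕ.+-identityʳ _))
  go₁ f inj (suc L) {suc i} (s≤s i<L) eq = trans (tally-++ q (map (f 0 ∷_) fs) _)
    (cong₂ _+_ (trans (tally-map q (f 0 ∷_) fs)
                 (tally-none (All.universal (λ g → none (f 0) g (λ eq′ → ℕ.0≢1+n (inj (trans eq′ (sym eq))))) fs)))
               (go₁ (f ∘ suc) (ℕ.suc-injective ∘ inj) L i<L eq))

∧-true : ∀ a {b} → a ∧ b ≡ true → a ≡ true × b ≡ true
∧-true true p = refl , p

⇔⇒≡ : ∀ {a b} → (a ≡ true → b ≡ true) → (b ≡ true → a ≡ true) → a ≡ b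
⇔⇒≡ {true}  {b}     f g = sym (f refl)
⇔⇒≡ {false} {false} f g = refl
⇔⇒≡ {false} {true}  f g = g refl

all⇒All : {A : Set} {q : A → Bool} (xs : List A) → all q xs ≡ true → All (λ x → q x ≡ true) xs
all⇒All []       p = []
all⇒All {q = q} (x ∷ xs) p with ∧-true (q x) p
... | px , pxs = px ∷ all⇒All xs pxs

All⇒all : {A : Set} {q : A → Bool} {xs : List A} → All (λ x → q x ≡ true) xs → all q xs ≡ true
All⇒all []                 = refl
All⇒all (p ∷ ps) rewrite p = All⇒all ps

≤ᵇ-true⇒≤ : ∀ {m n} → (m ≤ᵇ n) ≡ true → m ≤ n
≤ᵇ-true⇒≤ {m} {n} p = ℕ.≤ᵇ⇒≤ m n (subst Bool.T (sym p) _)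

T⇒true : ∀ {a} → Bool.T a → a ≡ true
T⇒true {true} _ = refl

≤⇒≤ᵇ-true : ∀ {m n} → m ≤ n → (m ≤ᵇ n) ≡ true
≤⇒≤ᵇ-true p = T⇒true (ℕ.≤⇒≤ᵇ p)

≡⇒≡ᵇ-true : ∀ {m n} → m ≡ n → (m ≡ᵇ n) ≡ true
≡⇒≡ᵇ-true {m} refl = ≡ᵇ-refl m

≢⇒≡ᵇ-false : ∀ {m n} → m ≢ n → (m ≡ᵇ n) ≡ false
≢⇒≡ᵇ-false {m} {n} p with m ≡ᵇ n in eq
... | true  = ⊥-elim (p (≡ᵇ-true⇒≡ eq))
... | false = refl

<⇒<ᵇ-true : ∀ {m n} → m < n → (m <ᵇ n) ≡ true
<⇒<ᵇ-true p = T⇒true (ℕ.<⇒<ᵇ p)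

listEqᵇ-true⇒≡ : ∀ xs ys → listEqᵇ xs ys ≡ true → xs ≡ ys
listEqᵇ-true⇒≡ []       []       p = refl
listEqᵇ-true⇒≡ (x ∷ xs) (y ∷ ys) p with ∧-true (x ≡ᵇ y) p
... | px , pxs = cong₂ _∷_ (≡ᵇ-true⇒≡ px) (listEqᵇ-true⇒≡ xs ys pxs)

listEqᵇ-refl : ∀ xs → listEqᵇ xs xs ≡ true
listEqᵇ-refl []                          = refl
listEqᵇ-refl (x ∷ xs) rewrite ≡ᵇ-refl x = listEqᵇ-refl xs

Sorted : List ℕ → Set
Sorted = AllPairs _≤_

-- The index sequence i₁, ..., iₙ of the monomial ∏ x_{f(u)}^{w(u)}, taken in the order of the
-- chain.
word : List Elem → List ℕ → List ℕ
word (u ∷ us) (x ∷ xs) = replicate (w u) x ++ word us xs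
word _        _        = []

occ : ℕ → List ℕ → ℕ
occ j []       = 0
occ j (x ∷ xs) = (if x ≡ᵇ j then 1 else 0) + occ j xs

occ-++ : ∀ j xs ys → occ j (xs ++ ys) ≡ occ j xs + occ j ys
occ-++ j []       ys = refl
occ-++ j (x ∷ xs) ys = trans (cong (_ ℕ.+_) (occ-++ j xs ys)) (sym (ℕ.+-assoc _ (occ j xs) (occ j ys)))

occ-replicate : ∀ j k x → occ j (replicate k x) ≡ (if x ≡ᵇ j then k else 0)
occ-replicate j zero    x with x ≡ᵇ j
... | true  = refl
... | false = refl
occ-replicate j (suc k) x with x ≡ᵇ j | occ-replicate j k x
... | true  | ih = cong suc ih
... | false | ih = ih

occ-none : ∀ {j xs} → All (j <_) xs → occ j xs ≡ 0
occ-none [] = refl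
occ-none {j} {x ∷ xs} (p ∷ ps) rewrite ≢⇒≡ᵇ-false {x} {j} (ℕ.<⇒≢ p ∘ sym) = occ-none ps

expAt-word : ∀ s f j → expAt s f j ≡ occ j (word s f)
expAt-word []       f        j = refl
expAt-word (u ∷ us) []       j = refl
expAt-word (u ∷ us) (x ∷ xs) j = sym (trans (occ-++ j (replicate (w u) x) (word us xs))
  (cong₂ _+_ (occ-replicate j (w u) x) (sym (expAt-word us xs j))))

sortedWordFrom-≥ : ∀ j e → All (j ≤_) (sortedWordFrom j e)
sortedWordFrom-≥ j []       = []
sortedWordFrom-≥ j (k ∷ ks) = All.++⁺ (All.replicate⁺ k ℕ.≤-refl) (All.map (ℕ.≤-trans (ℕ.n≤1+n j)) (sortedWordFrom-≥ (suc j) ks))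

replicate-sorted : ∀ k x → Sorted (replicate k x)
replicate-sorted zero    x = []
replicate-sorted (suc k) x = All.replicate⁺ k ℕ.≤-refl ∷ replicate-sorted k x

replicate-++-sorted : ∀ k x {V} → All (x ≤_) V → Sorted V → Sorted (replicate k x ++ V)
replicate-++-sorted k x p q = AllPairs.++⁺ (replicate-sorted k x) q (All.replicate⁺ k p)

sortedWordFrom-sorted : ∀ j e → Sorted (sortedWordFrom j e)
sortedWordFrom-sorted j []       = []
sortedWordFrom-sorted j (k ∷ ks) = replicate-++-sorted k j
  (All.map (ℕ.≤-trans (ℕ.n≤1+n j)) (sortedWordFrom-≥ (suc j) ks)) (sortedWordFrom-sorted (suc j) ks)

sortedWordFrom-< : ∀ j e → All (_< j + length e) (sortedWordFrom j e)
sortedWordFrom-< j []       = []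
sortedWordFrom-< j (k ∷ ks) = All.++⁺ (All.replicate⁺ k (ℕ.m<m+n j (s≤s z≤n)))
  (All.map (λ {x} p → subst (x <_) (sym (ℕ.+-suc j (length ks))) p) (sortedWordFrom-< (suc j) ks))

occ-sortedWordFrom : ∀ j e i → occ (i + j) (sortedWordFrom j e) ≡ nth e i
occ-sortedWordFrom j []       i = refl
occ-sortedWordFrom j (k ∷ ks) i =
  trans (occ-++ (i + j) (replicate k j) _)
    (trans (cong (ℕ._+ occ (i + j) (sortedWordFrom (suc j) ks)) (occ-replicate (i + j) k j)) (split i))
  where
  split : ∀ i → (if j ≡ᵇ i + j then k else 0) + occ (i + j) (sortedWordFrom (suc j) ks) ≡ nth (k ∷ ks) i
  split zero rewrite ≡ᵇ-refl j =
    trans (cong (k ℕ.+_) (occ-none (sortedWordFrom-≥ (suc j) ks))) (ℕ.+-identityʳ k)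
  split (suc i) rewrite ≢⇒≡ᵇ-false {j} {suc (i + j)} (ℕ.<⇒≢ (s≤s (ℕ.m≤n+m j i))) | sym (ℕ.+-suc i j) =
    occ-sortedWordFrom (suc j) ks i

-- Exponent 0 means that `j` is absent, so the lower bound rises to `suc j`. With a positive
-- exponent `j` occurs, and by sortedness it is the first letter; removing it lowers the exponent by
-- one.
sorted-unique : ∀ j e V → Sorted V → All (λ v → j ≤ v × v < j + length e) V →
  (∀ i → i < length e → occ (i + j) V ≡ nth e i) → V ≡ sortedWordFrom j e
sorted-unique j [] [] sV bV oV = refl
sorted-unique j [] (v ∷ V) sV ((p , q) ∷ bV) oV =
  ⊥-elim (ℕ.<-irrefl refl (ℕ.≤-<-trans p (subst (v <_) (ℕ.+-identityʳ j) q)))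
sorted-unique j (zero ∷ e) V sV bV oV = sorted-unique (suc j) e V sV (raise V bV (oV 0 (s≤s z≤n)))
  (λ i i< → trans (cong (λ k → occ k V) (ℕ.+-suc i j)) (oV (suc i) (s≤s i<)))
  where
  raise : ∀ V → All (λ v → j ≤ v × v < j + suc (length e)) V → occ j V ≡ 0 →
    All (λ v → suc j ≤ v × v < suc j + length e) V
  raise []      []               o = []
  raise (v ∷ V) ((p , q) ∷ bV) o with v ≡ᵇ j in eq
  ... | false = (ℕ.≤∧≢⇒< p (λ { refl → Bool.not-¬ (≡ᵇ-refl v) eq }) , subst (v <_) (ℕ.+-suc j (length e)) q) ∷ raise V bV o
sorted-unique j (suc k ∷ e) V sV bV oV = uncons V sV bV oV
  where
  uncons : ∀ V → Sorted V → All (λ v → j ≤ v × v < j + length (suc k ∷ e)) V →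
    (∀ i → i < length (suc k ∷ e) → occ (i + j) V ≡ nth (suc k ∷ e) i) → V ≡ sortedWordFrom j (suc k ∷ e)
  uncons [] sV bV oV with oV 0 (s≤s z≤n)
  ... | ()
  uncons (v ∷ V) (pV ∷ sV) ((p , q) ∷ bV) oV with v ≡ᵇ j in eq
  ... | false = ⊥-elim (ℕ.0≢1+n (trans (sym (occ-none (j<v ∷ All.map (ℕ.<-≤-trans j<v) pV))) (oV 0 (s≤s z≤n))))
    where j<v = ℕ.≤∧≢⇒< p (λ { refl → Bool.not-¬ (≡ᵇ-refl v) eq })
  ... | true with ≡ᵇ-true⇒≡ {v} {j} eq
  ... | refl = cong (v ∷_) (sorted-unique v (k ∷ e) V sV bV occ′)
    where
    occ′ : ∀ i → i < suc (length e) → occ (i + v) V ≡ nth (k ∷ e) i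
    occ′ zero i< with oV 0 i<
    ... | o rewrite eq = ℕ.suc-injective o
    occ′ (suc i) i< with oV (suc i) i<
    ... | o rewrite ≢⇒≡ᵇ-false {v} {suc (i + v)} (ℕ.<⇒≢ (s≤s (ℕ.m≤n+m v i))) = o

-- Chains and their gap words

Labelling : Set
Labelling = Elem → Elem → Bool

Transitive : Labelling → Set
Transitive lt = ∀ a b c → lt a b ≡ true → lt b c ≡ true → lt a c ≡ true

-- Blocks of w(u) equal indices, separated according to the labels of consecutive elements.
mutual
  chainGaps : Labelling → List Elem → List Gap
  chainGaps lt []       = []
  chainGaps lt (u ∷ us) = replicate (pred (w u)) equal ++ linkGaps lt u us

  linkGaps : Labelling → Elem → List Elem → List Gap
  linkGaps lt u []       = []
  linkGaps lt u (v ∷ vs) = fromBit (not (lt u v)) ∷ chainGaps lt (v ∷ vs)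

below : Labelling → Elem → ℕ → Elem × ℕ → Bool
below lt u x vy = (x ≤ᵇ proj₂ vy) ∧ (not (x ≡ᵇ proj₂ vy) ∨ lt u (proj₁ vy))

below⇒ : ∀ lt u x v y → below lt u x (v , y) ≡ true → x ≤ y × (x ≡ y → lt u v ≡ true)
below⇒ lt u x v y p with ∧-true (x ≤ᵇ y) p
... | q , r = ≤ᵇ-true⇒≤ q , λ { refl → subst (λ b → not b ∨ lt u v ≡ true) (≡ᵇ-refl x) r }

⇒below : ∀ lt u x v y → x ≤ y → (x ≡ y → lt u v ≡ true) → below lt u x (v , y) ≡ true
⇒below lt u x v y p q rewrite ≤⇒≤ᵇ-true p with x ≡ᵇ y in eq
... | true  = q (≡ᵇ-true⇒≡ eq)
... | false = refl

allows-below : ∀ lt u y v z → y ≤ z → allows (fromBit (not (lt u v))) (y <ᵇ z) ≡ below lt u y (v , z)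
allows-below lt u y v z p with ℕ.m≤n⇒m<n∨m≡n p
... | inj₂ refl rewrite ≤⇒≤ᵇ-true p | ≡ᵇ-refl y | <ᵇ-irrefl y with lt u v
...   | true  = refl
...   | false = refl
allows-below lt u y v z p | inj₁ y<z
  rewrite ≤⇒≤ᵇ-true p | ≢⇒≡ᵇ-false (ℕ.<⇒≢ y<z) | <⇒<ᵇ-true y<z with lt u v
...   | true  = refl
...   | false = refl

-- Why neighbours suffice: the partition condition on a chain compares all pairs, but the
-- inequalities compose. If the outer values coincide, all three do, and the labels compose by
-- transitivity.
all-below-trans : ∀ lt → Transitive lt → ∀ u y v z vs xs → below lt u y (v , z) ≡ true →
  all (below lt v z) (zip vs xs) ≡ true → all (below lt u y) (zip vs xs) ≡ true
all-below-trans lt tr u y v z vs xs p q =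
  All⇒all (All.map (λ {vx} → step vx) (all⇒All (zip vs xs) q))
  where
  y≤z = proj₁ (below⇒ lt u y v z p)
  step : ∀ vx → below lt v z vx ≡ true → below lt u y vx ≡ true
  step (v′ , x) r with below⇒ lt v z v′ x r
  ... | z≤x , s = ⇒below lt u y v′ x (ℕ.≤-trans y≤z z≤x)
    (λ { refl → tr u v v′ (proj₂ (below⇒ lt u y v z p) (ℕ.≤-antisym y≤z z≤x)) (s (ℕ.≤-antisym z≤x y≤z)) })

allMaps-bounds : ∀ ℓ L → All (λ f → length f ≡ ℓ × All (λ x → 1 ≤ x × x < 1 + L) f) (allMaps ℓ L)
allMaps-bounds zero    L = (refl , []) ∷ []
allMaps-bounds (suc ℓ) L = All.concat⁺ (All.map⁺ (All.map⁺ (All.applyUpTo⁺₁ id L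
  (λ i<L → All.map⁺ (All.map (λ (l , b) → cong suc l , (s≤s z≤n , s≤s i<L) ∷ b) (allMaps-bounds ℓ L))))))

word-All : ∀ {P : ℕ → Set} s f → All P f → All P (word s f)
word-All []       f        p        = []
word-All (u ∷ us) []       p        = []
word-All (u ∷ us) (y ∷ ys) (p ∷ ps) = All.++⁺ (All.replicate⁺ (w u) p) (word-All us ys ps)

word-sorted : ∀ lt s f → length f ≡ length s → isPartitionᵇ lt s f ≡ true → Sorted (word s f)
word-sorted lt []       []       l p = []
word-sorted lt (u ∷ us) (x ∷ xs) l p with ∧-true (all (below lt u x) (zip us xs)) p
... | q , r = replicate-++-sorted (w u) x
    (word-All us xs (bound us xs (ℕ.suc-injective l) (all⇒All (zip us xs) q)))
    (word-sorted lt us xs (ℕ.suc-injective l) r)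
  where
  bound : ∀ us xs → length xs ≡ length us → All (λ vy → below lt u x vy ≡ true) (zip us xs) → All (x ≤_) xs
  bound []       []       l []       = []
  bound (v ∷ us) (y ∷ xs) l (p ∷ ps) = proj₁ (below⇒ lt u x v y p) ∷ bound us xs (ℕ.suc-injective l) ps

-- The partition condition makes the word weakly increasing, and such a word is determined by how
-- often each index occurs. Hence comparing exponents amounts to comparing words.
monomialIsᵇ-word : ∀ lt s f e → length f ≡ length s × All (λ x → 1 ≤ x × x < 1 + length e) f →
  isPartitionᵇ lt s f ≡ true → monomialIsᵇ s f e ≡ listEqᵇ (word s f) (sortedWord e)
monomialIsᵇ-word lt s f e (l , b) p rewrite sortedWord-From e =
  trans (all-map _ suc (upTo (length e))) (⇔⇒≡ forth back)
  where
  forth : all (λ i → expAt s f (suc i) ≡ᵇ nth e i) (upTo (length e)) ≡ true →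
    listEqᵇ (word s f) (sortedWordFrom 1 e) ≡ true
  forth q = subst (λ V → listEqᵇ (word s f) V ≡ true)
    (sorted-unique 1 e (word s f) (word-sorted lt s f l p) (word-All s f b)
      (λ i i< → trans (cong (λ k → occ k (word s f)) (ℕ.+-comm i 1))
        (trans (sym (expAt-word s f (suc i)))
          (≡ᵇ-true⇒≡ (All.applyUpTo⁻ id (length e) (all⇒All (upTo (length e)) q) i<)))))
    (listEqᵇ-refl (word s f))
  back : listEqᵇ (word s f) (sortedWordFrom 1 e) ≡ true →
    all (λ i → expAt s f (suc i) ≡ᵇ nth e i) (upTo (length e)) ≡ true
  back q = All⇒all (All.applyUpTo⁺₂ id (length e) (λ i → ≡⇒≡ᵇ-true
    (trans (expAt-word s f (suc i))
      (trans (cong₂ occ (ℕ.+-comm 1 i) (listEqᵇ-true⇒≡ (word s f) (sortedWordFrom 1 e) q)) (occ-sortedWordFrom 1 e i)))))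

-- Counting the partitions of a chain with a given word

∧-absorb : ∀ h t {r p c} → (h ≡ true → t ≡ true → r ≡ true) →
  ((h ∧ r) ∧ (t ∧ p)) ∧ c ≡ h ∧ ((t ∧ p) ∧ c)
∧-absorb false t     imp = refl
∧-absorb true  true  imp rewrite imp refl refl = refl
∧-absorb true  false {r} imp rewrite Bool.∧-zeroʳ r = refl

InRange : ℕ → ℕ → Set
InRange L x = 1 ≤ x × x < 1 + L

module _ (lt : Labelling) (tr : Transitive lt) (L : ℕ) where

  matches : List Elem → List ℕ → List ℕ → Bool
  matches s V f = isPartitionᵇ lt s f ∧ listEqᵇ (word s f) V

  -- The comparisons of `u` with everything after `v` are absorbed by those of `v`, leaving only the
  -- link letter. The weight of `v` is matched as a successor so that its word visibly starts with
  -- `x`; if `x` is not `z`, both sides are `false`.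
  matches-head : ∀ u y v vs z V → All (λ u → 1 ≤ w u) (v ∷ vs) → y ≤ z → ∀ f → length f ≡ length (v ∷ vs) →
    (all (below lt u y) (zip (v ∷ vs) f) ∧ isPartitionᵇ lt (v ∷ vs) f) ∧ listEqᵇ (word (v ∷ vs) f) (z ∷ V)
    ≡ allows (fromBit (not (lt u v))) (y <ᵇ z) ∧ matches (v ∷ vs) (z ∷ V) f
  matches-head u y (suc b , k) vs z V (_ ∷ _) y≤z (x ∷ xs) l
    rewrite allows-below lt u y (suc b , k) z y≤z with x ≡ᵇ z in eq
  ... | false = trans (Bool.∧-zeroʳ (all (below lt u y) (zip (v ∷ vs) (x ∷ xs)) ∧ isPartitionᵇ lt (v ∷ vs) (x ∷ xs)))
    (sym (trans (cong (below lt u y (v , z) ∧_) (Bool.∧-zeroʳ (isPartitionᵇ lt (v ∷ vs) (x ∷ xs))))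
                (Bool.∧-zeroʳ (below lt u y (v , z)))))
    where v = suc b , k
  ... | true with ≡ᵇ-true⇒≡ {x} {z} eq
  ...   | refl = ∧-absorb (below lt u y (v , z)) (all (below lt v z) (zip vs xs))
      (all-below-trans lt tr u y v z vs xs)
    where v = suc b , k

  mutual
    -- The first letter of `V` forces the value at the first element, and so on along the chain; so
    -- at most one map survives, and the gap word decides whether it does.
    tally-matches : ∀ s V → All (λ u → 1 ≤ w u) s → Sorted V → All (InRange L) V →
      tally (matches s V) (allMaps (length s) L)
      ≡ boolToℕ ((length V ≡ᵇ sum (map w s)) ∧ compat (chainGaps lt s) (ascents V))
    tally-matches [] []      ws sV bV = refl
    tally-matches [] (_ ∷ _) ws sV bV = refl
    tally-matches ((suc a , k) ∷ us) [] (_ ∷ ws) sV bV = tally-none (All.map (λ {f} → none f) (allMaps-bounds _ L))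
      where
      none : ∀ f → length f ≡ suc (length us) × _ → matches ((suc a , k) ∷ us) [] f ≡ false
      none (x ∷ xs) _ = Bool.∧-zeroʳ (isPartitionᵇ lt ((suc a , k) ∷ us) (x ∷ xs))
    tally-matches ((suc a , k) ∷ us) (suc y ∷ V) (_ ∷ ws) sV ((_ , s≤s y<L) ∷ bV) =
      trans (tally-head (matches ((suc a , k) ∷ us) (suc y ∷ V)) L y (allMaps (length us) L) y<L other)
        (trans (tally-cong (All.universal same (allMaps (length us) L)))
          (tally-block (suc a , k) us (suc y) a V ws sV bV))
      where
      other : ∀ x f → x ≢ suc y → matches ((suc a , k) ∷ us) (suc y ∷ V) (x ∷ f) ≡ false
      other x f p rewrite ≢⇒≡ᵇ-false p = Bool.∧-zeroʳ (isPartitionᵇ lt ((suc a , k) ∷ us) (x ∷ f))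
      same : ∀ f → matches ((suc a , k) ∷ us) (suc y ∷ V) (suc y ∷ f) ≡
        (all (below lt (suc a , k) (suc y)) (zip us f) ∧ isPartitionᵇ lt us f)
          ∧ listEqᵇ (replicate a (suc y) ++ word us f) V
      same f rewrite ≡ᵇ-refl y = refl

    -- The state inside a block: `u` has the value `y`, and `a` further copies of `y` must be read
    -- off `V` before the next element begins.
    tally-block : ∀ u us y a V → All (λ u → 1 ≤ w u) us → Sorted (y ∷ V) → All (InRange L) V →
      tally (λ f → (all (below lt u y) (zip us f) ∧ isPartitionᵇ lt us f)
                     ∧ listEqᵇ (replicate a y ++ word us f) V) (allMaps (length us) L)
      ≡ boolToℕ ((length V ≡ᵇ a + sum (map w us))
                   ∧ compat (replicate a equal ++ linkGaps lt u us) (ascents (y ∷ V)))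
    tally-block u us y (suc a) [] ws sV bV =
      tally-none (All.universal (λ f → Bool.∧-zeroʳ _) (allMaps (length us) L))
    tally-block u us y (suc a) (z ∷ V) ws (yV ∷ sV) (_ ∷ bV) with y ≡ᵇ z in eq
    ... | true with ≡ᵇ-true⇒≡ {y} {z} eq
    ...   | refl rewrite <ᵇ-irrefl y = tally-block u us y a V ws sV bV
    -- The block should continue with `y`, but `z` is larger: no map matches, and the letter `equal`
    -- rejects the ascent.
    tally-block u us y (suc a) (z ∷ V) ws ((y≤z ∷ _) ∷ sV) (_ ∷ bV) | false
      rewrite <⇒<ᵇ-true (ℕ.≤∧≢⇒< y≤z (λ { refl → Bool.not-¬ (≡ᵇ-refl y) eq })) =
      trans (tally-none (All.universal (λ f → Bool.∧-zeroʳ _) (allMaps (length us) L)))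
        (cong boolToℕ (sym (Bool.∧-zeroʳ (length V ≡ᵇ a + sum (map w us)))))
    tally-block u [] y zero []      ws sV bV = refl
    tally-block u [] y zero (_ ∷ _) ws sV bV = refl
    tally-block u ((zero , _) ∷ vs) y zero [] (() ∷ _) sV bV
    tally-block u ((suc b , k) ∷ vs) y zero [] (_ ∷ _) sV bV =
      tally-none (All.map (λ {f} → none f) (allMaps-bounds _ L))
      where
      none : ∀ f → length f ≡ suc (length vs) × _ →
        (all (below lt u y) (zip ((suc b , k) ∷ vs) f) ∧ isPartitionᵇ lt ((suc b , k) ∷ vs) f)
          ∧ listEqᵇ (word ((suc b , k) ∷ vs) f) [] ≡ false
      none (x ∷ xs) _ = Bool.∧-zeroʳ _
    -- The block of `u` is used up, so `z` has to be the value at `v`. The link letter tests the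
    -- step from `y` to `z`, and the count continues with the chain from `v`.
    tally-block u (v ∷ vs) y zero (z ∷ V) ws ((y≤z ∷ _) ∷ sV) bV =
      trans (tally-cong (All.map (λ {f} (l , _) → matches-head u y v vs z V ws y≤z f l) (allMaps-bounds _ L)))
        (trans (tally-∧ (allows (fromBit (not (lt u v))) (y <ᵇ z)) (matches (v ∷ vs) (z ∷ V)) (allMaps (suc (length vs)) L)
                 (tally-matches (v ∷ vs) (z ∷ V) ws sV bV))
          (cong boolToℕ (∧-swap (allows (fromBit (not (lt u v))) (y <ᵇ z)) (length (z ∷ V) ≡ᵇ sum (map w (v ∷ vs))) _)))

K-chain-gaps : ∀ lt → Transitive lt → ∀ s e → All (λ u → 1 ≤ w u) s →
  K-chain lt s e ≡ boolToℤ (sum e ≡ᵇ sum (map w s)) *ℤ ⟦ chainGaps lt s ⟧ (gaps e)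
K-chain-gaps lt tr s e ws =
  trans (cong +_ (trans
    (tally-cong (All.map (λ {f} b → ∧-cong-if (monomialIsᵇ-word lt s f e b)) (allMaps-bounds (length s) (length e))))
    (tally-matches lt tr (length e) s (sortedWord e) ws
      (subst Sorted (sym (sortedWord-From e)) (sortedWordFrom-sorted 1 e))
      (subst (All (InRange (length e))) (sym (sortedWord-From e))
        (All.zip (sortedWordFrom-≥ 1 e , sortedWordFrom-< 1 e))))))
    (trans (cong (λ k → + boolToℕ ((k ≡ᵇ sum (map w s)) ∧ compat (chainGaps lt s) (gaps e))) (length-sortedWord e))
      (product (sum e ≡ᵇ sum (map w s)) (compat (chainGaps lt s) (gaps e))))
  where
  product : ∀ a b → + boolToℕ (a ∧ b) ≡ boolToℤ a *ℤ boolToℤ b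
  product true  true  = refl
  product true  false = refl
  product false b     = refl

-- Reversal, duality and sign for chains

reverse-replicate : {A : Set} (k : ℕ) (x : A) → reverse (replicate k x) ≡ replicate k x
reverse-replicate zero    x = refl
reverse-replicate (suc k) x = trans (unfold-reverse x (replicate k x))
  (trans (cong (_∷ʳ x) (reverse-replicate k x)) (snoc k))
  where
  snoc : ∀ k → replicate k x ∷ʳ x ≡ x ∷ replicate k x
  snoc zero    = refl
  snoc (suc k) = cong (x ∷_) (snoc k)

chainGaps-∷ʳ : ∀ lt us u v → chainGaps lt ((us ∷ʳ u) ∷ʳ v) ≡
  chainGaps lt (us ∷ʳ u) ++ fromBit (not (lt u v)) ∷ replicate (pred (w v)) equal
chainGaps-∷ʳ lt [] u v =
  trans (cong (λ gs → replicate (pred (w u)) equal ++ fromBit (not (lt u v)) ∷ gs) (++-identityʳ _))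
    (cong (_++ fromBit (not (lt u v)) ∷ replicate (pred (w v)) equal) (sym (++-identityʳ (replicate (pred (w u)) equal))))
chainGaps-∷ʳ lt (t ∷ []) u v =
  trans (cong (λ gs → replicate (pred (w t)) equal ++ fromBit (not (lt t u)) ∷ gs) (chainGaps-∷ʳ lt [] u v))
    (sym (++-assoc (replicate (pred (w t)) equal) _ _))
chainGaps-∷ʳ lt (t ∷ t′ ∷ us) u v =
  trans (cong (λ gs → replicate (pred (w t)) equal ++ fromBit (not (lt t t′)) ∷ gs) (chainGaps-∷ʳ lt (t′ ∷ us) u v))
    (sym (++-assoc (replicate (pred (w t)) equal) _ _))

-- Blocks of = are palindromes. A link letter depends on the labels of two neighbours, which the
-- reversed chain lists in the other order; flipping the labelling keeps the letter the same.
chainGaps-reverse : ∀ lt s → reverse (chainGaps lt s) ≡ chainGaps (flip lt) (reverse s)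
chainGaps-reverse lt []      = refl
chainGaps-reverse lt (v ∷ []) rewrite ++-identityʳ (replicate (pred (w v)) equal) = reverse-replicate (pred (w v)) equal
chainGaps-reverse lt (v ∷ u ∷ us) = begin
  reverse (block ++ g ∷ rest)                           ≡⟨ reverse-++ block (g ∷ rest) ⟩
  reverse (g ∷ rest) ++ reverse block                   ≡⟨ cong₂ _++_ (unfold-reverse g rest) (reverse-replicate (pred (w v)) equal) ⟩
  (reverse rest ∷ʳ g) ++ block                          ≡⟨ ++-assoc (reverse rest) _ block ⟩
  reverse rest ++ g ∷ block                             ≡⟨ cong (_++ g ∷ block) (chainGaps-reverse lt (u ∷ us)) ⟩
  chainGaps (flip lt) (reverse (u ∷ us)) ++ g ∷ block   ≡⟨ cong (λ t → chainGaps (flip lt) t ++ g ∷ block) (unfold-reverse u us) ⟩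
  chainGaps (flip lt) (reverse us ∷ʳ u) ++ g ∷ block    ≡⟨ chainGaps-∷ʳ (flip lt) (reverse us) u v ⟨
  chainGaps (flip lt) ((reverse us ∷ʳ u) ∷ʳ v)          ≡⟨ cong (λ t → chainGaps (flip lt) (t ∷ʳ v)) (unfold-reverse u us) ⟨
  chainGaps (flip lt) (reverse (u ∷ us) ∷ʳ v)           ≡⟨ cong (chainGaps (flip lt)) (unfold-reverse v (u ∷ us)) ⟨
  chainGaps (flip lt) (reverse (v ∷ u ∷ us))            ∎
  where
  open ≡-Reasoning
  block = replicate (pred (w v)) equal
  g     = fromBit (not (lt v u))
  rest  = chainGaps lt (u ∷ us)

-- Restricted to distinct elements, because two reverse strict orders are both false on the
-- diagonal.
Opposite : Labelling → Labelling → Set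
Opposite lt lt* = ∀ u v → u ≢ v → lt* u v ≡ not (lt u v)

map-dual-chainGaps : ∀ {lt lt*} → Opposite lt lt* → ∀ s → Unique s → map dual (chainGaps lt s) ≡ chainGaps lt* s
map-dual-chainGaps {lt} {lt*} op [] _ = refl
map-dual-chainGaps {lt} {lt*} op (u ∷ us) (u∉us ∷ uniq) =
  trans (map-++ dual (replicate (pred (w u)) equal) (linkGaps lt u us))
    (cong₂ _++_ (map-replicate dual (pred (w u)) equal) (link us u∉us uniq))
  where
  link : ∀ us → All (u ≢_) us → Unique us → map dual (linkGaps lt u us) ≡ linkGaps lt* u us
  link []       _         _    = refl
  link (v ∷ vs) (u≢v ∷ _) uniq = cong₂ _∷_
    (trans (sym (dual-fromBit (not (lt u v)))) (cong (fromBit ∘ not) (sym (op u v u≢v))))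
    (map-dual-chainGaps op (v ∷ vs) uniq)

equals-replicate : ∀ k gs → equals (replicate k equal ++ gs) ≡ k + equals gs
equals-replicate zero    gs = refl
equals-replicate (suc k) gs = cong suc (equals-replicate k gs)

equals-fromBit : ∀ b gs → equals (fromBit b ∷ gs) ≡ equals gs
equals-fromBit true  gs = refl
equals-fromBit false gs = refl

-- Each `u` contributes w(u) - 1 letters =, and links contribute none. The additive form postpones
-- truncated subtraction.
equals-chainGaps : ∀ lt s → All (λ u → 1 ≤ w u) s → equals (chainGaps lt s) + length s ≡ sum (map w s)
equals-chainGaps lt []                   _        = refl
equals-chainGaps lt ((suc a , k) ∷ []) (_ ∷ _) =
  trans (cong (ℕ._+ 1) (equals-replicate a [])) (trans (cong (ℕ._+ 1) (ℕ.+-identityʳ a))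
    (trans (ℕ.+-comm a 1) (cong suc (sym (ℕ.+-identityʳ a)))))
equals-chainGaps lt (u@(suc a , k) ∷ v ∷ vs) (_ ∷ ws) = begin
  equals (replicate a equal ++ g ∷ rest) + suc (length (v ∷ vs))  ≡⟨ ℕ.+-suc _ _ ⟩
  suc (equals (replicate a equal ++ g ∷ rest) + length (v ∷ vs))  ≡⟨ cong (λ m → suc (m + length (v ∷ vs))) (trans (equals-replicate a (g ∷ rest)) (cong (a ℕ.+_) (equals-fromBit (not (lt u v)) rest))) ⟩
  suc ((a + equals rest) + length (v ∷ vs))                       ≡⟨ cong suc (ℕ.+-assoc a _ _) ⟩
  suc (a + (equals rest + length (v ∷ vs)))                       ≡⟨ cong (λ m → suc (a + m)) (equals-chainGaps lt (v ∷ vs) ws) ⟩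
  suc (a + sum (map w (v ∷ vs)))                                  ∎
  where
  open ≡-Reasoning
  g    = fromBit (not (lt u v))
  rest = chainGaps lt (v ∷ vs)

-- The two labellings

≮⇒<ᵇ-false : ∀ {m n} → n ≤ m → (m <ᵇ n) ≡ false
≮⇒<ᵇ-false {m} {n} p with m <ᵇ n in eq
... | false = refl
... | true  = ⊥-elim (ℕ.≤⇒≯ p (ℕ.<ᵇ⇒< m n (subst Bool.T (sym eq) _)))

<ℕℕ-opposite : ∀ p q → p ≢ q → (q <ℕℕ p) ≡ not (p <ℕℕ q)
<ℕℕ-opposite (a , k) (b , l) p≢q with ℕ.<-cmp a b
... | tri< a<b _ _ rewrite <⇒<ᵇ-true a<b | ≮⇒<ᵇ-false (ℕ.<⇒≤ a<b) | ≢⇒≡ᵇ-false (ℕ.<⇒≢ a<b ∘ sym) = refl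
... | tri> _ _ b<a rewrite <⇒<ᵇ-true b<a | ≮⇒<ᵇ-false (ℕ.<⇒≤ b<a) | ≢⇒≡ᵇ-false (ℕ.<⇒≢ b<a ∘ sym) = refl
... | tri≈ _ refl _ rewrite <ᵇ-irrefl a | ≡ᵇ-refl a with ℕ.<-cmp k l
...   | tri< k<l _ _ rewrite <⇒<ᵇ-true k<l | ≮⇒<ᵇ-false (ℕ.<⇒≤ k<l) = refl
...   | tri> _ _ l<k rewrite <⇒<ᵇ-true l<k | ≮⇒<ᵇ-false (ℕ.<⇒≤ l<k) = refl
...   | tri≈ _ refl _ = ⊥-elim (p≢q refl)

<ᵇ-true⇒< : ∀ m n → (m <ᵇ n) ≡ true → m < n
<ᵇ-true⇒< m n p = ℕ.<ᵇ⇒< m n (subst Bool.T (sym p) _)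

<ℕℕ-trans : Transitive _<ℕℕ_
<ℕℕ-trans (a , k) (b , l) (c , m) p q with a <ᵇ b in a<b | b <ᵇ c in b<c
... | true | true rewrite <⇒<ᵇ-true (ℕ.<-trans (<ᵇ-true⇒< a b a<b) (<ᵇ-true⇒< b c b<c)) = refl
... | true | false with ≡ᵇ-true⇒≡ {b} {c} (proj₁ (∧-true (b ≡ᵇ c) q))
...   | refl rewrite a<b = refl
<ℕℕ-trans (a , k) (b , l) (c , m) p q | false | t with ≡ᵇ-true⇒≡ {a} {b} (proj₁ (∧-true (a ≡ᵇ b) p))
<ℕℕ-trans (a , k) (b , l) (c , m) p q | false | true  | refl rewrite b<c = refl
<ℕℕ-trans (a , k) (b , l) (c , m) p q | false | false | refl with ≡ᵇ-true⇒≡ {b} {c} (proj₁ (∧-true (b ≡ᵇ c) q))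
... | refl rewrite a<b | ≡ᵇ-refl a = <⇒<ᵇ-true (ℕ.<-trans (<ᵇ-true⇒< k l p) (<ᵇ-true⇒< l m q))

γ-trans : Transitive γ-lt
γ-trans a b c p q = <ℕℕ-trans c b a q p

γ-γ*-opposite : Opposite γ-lt γ*-lt
γ-γ*-opposite u v u≢v = <ℕℕ-opposite v u (u≢v ∘ sym)

γ*-γ-opposite : Opposite γ*-lt γ-lt
γ*-γ-opposite = <ℕℕ-opposite

-- Linear extensions and their reversal

insertions-↭ : {A : Set} (x : A) (ys : List A) → All (_↭ x ∷ ys) (insertions x ys)
insertions-↭ x []       = ↭.refl ∷ []
insertions-↭ x (y ∷ ys) = ↭.refl ∷ All.map⁺ (All.map (λ p → ↭.trans (↭.prep y p) (↭.swap y x ↭.refl)) (insertions-↭ x ys))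

perms-↭ : {A : Set} (xs : List A) → All (_↭ xs) (perms xs)
perms-↭ []       = ↭.refl ∷ []
perms-↭ (x ∷ xs) = All.concat⁺ (All.map⁺ (All.map
  (λ {t} p → All.map (λ q → ↭.trans q (↭.prep x p)) (insertions-↭ x t)) (perms-↭ xs)))

-- The recursion of `insertions` from the right end: `x` goes either after `y` or somewhere into
-- `ys`.
∑-insertions-∷ʳ : {A : Set} (x y : A) (ys : List A) (h : List A → ℤ) →
  ∑ (insertions x (ys ∷ʳ y)) h ≡ h ((ys ∷ʳ y) ∷ʳ x) +ℤ ∑ (insertions x ys) (h ∘ (_∷ʳ y))
∑-insertions-∷ʳ x y [] h = swap₃ (h (x ∷ y ∷ [])) (h (y ∷ x ∷ []))
  where
  swap₃ : ∀ a b → a +ℤ (b +ℤ + 0) ≡ b +ℤ (a +ℤ + 0)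
  swap₃ = solve-∀
∑-insertions-∷ʳ x y (z ∷ zs) h = begin
  h (x ∷ z ∷ zs ∷ʳ y) +ℤ ∑ (map (z ∷_) (insertions x (zs ∷ʳ y))) h
    ≡⟨ cong (h (x ∷ z ∷ zs ∷ʳ y) +ℤ_) (trans (∑-map (z ∷_) (insertions x (zs ∷ʳ y)) h) (∑-insertions-∷ʳ x y zs (h ∘ (z ∷_)))) ⟩
  h (x ∷ z ∷ zs ∷ʳ y) +ℤ (h (z ∷ (zs ∷ʳ y) ∷ʳ x) +ℤ ∑ (insertions x zs) (λ s → h (z ∷ s ∷ʳ y)))
    ≡⟨ rotate (h (x ∷ z ∷ zs ∷ʳ y)) (h (z ∷ (zs ∷ʳ y) ∷ʳ x)) _ ⟩
  h (z ∷ (zs ∷ʳ y) ∷ʳ x) +ℤ (h (x ∷ z ∷ zs ∷ʳ y) +ℤ ∑ (insertions x zs) (λ s → h (z ∷ s ∷ʳ y)))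
    ≡⟨ cong (λ a → h (z ∷ (zs ∷ʳ y) ∷ʳ x) +ℤ (h (x ∷ z ∷ zs ∷ʳ y) +ℤ a)) (∑-map (z ∷_) (insertions x zs) (h ∘ (_∷ʳ y))) ⟨
  h (z ∷ (zs ∷ʳ y) ∷ʳ x) +ℤ (h (x ∷ z ∷ zs ∷ʳ y) +ℤ ∑ (map (z ∷_) (insertions x zs)) (h ∘ (_∷ʳ y))) ∎
  where
  open ≡-Reasoning
  rotate : ∀ a b c → a +ℤ (b +ℤ c) ≡ b +ℤ (a +ℤ c)
  rotate = solve-∀

∑-insertions-reverse : {A : Set} (x : A) (t : List A) (h : List A → ℤ) →
  ∑ (insertions x t) (h ∘ reverse) ≡ ∑ (insertions x (reverse t)) h
∑-insertions-reverse x []       h = refl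
∑-insertions-reverse x (y ∷ ys) h = begin
  h (reverse (x ∷ y ∷ ys)) +ℤ ∑ (map (y ∷_) (insertions x ys)) (h ∘ reverse)
    ≡⟨ cong₂ _+ℤ_ (cong h (trans (unfold-reverse x (y ∷ ys)) (cong (_∷ʳ x) (unfold-reverse y ys))))
         (trans (∑-map (y ∷_) (insertions x ys) (h ∘ reverse))
           (trans (∑-cong (insertions x ys) (λ s → cong h (unfold-reverse y s)))
             (∑-insertions-reverse x ys (h ∘ (_∷ʳ y))))) ⟩
  h ((reverse ys ∷ʳ y) ∷ʳ x) +ℤ ∑ (insertions x (reverse ys)) (h ∘ (_∷ʳ y))
    ≡⟨ ∑-insertions-∷ʳ x y (reverse ys) h ⟨
  ∑ (insertions x (reverse ys ∷ʳ y)) h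
    ≡⟨ cong (λ t → ∑ (insertions x t) h) (unfold-reverse y ys) ⟨
  ∑ (insertions x (reverse (y ∷ ys))) h ∎
  where open ≡-Reasoning

-- Reversing an insertion of `x` into `t` inserts `x` into the reversed `t`, so the induction
-- hypothesis applies to the inner sum as a function of `t`. Working with sums avoids an explicit
-- rearrangement of the enumeration.
∑-perms-reverse : {A : Set} (xs : List A) (h : List A → ℤ) → ∑ (perms xs) (h ∘ reverse) ≡ ∑ (perms xs) h
∑-perms-reverse []       h = refl
∑-perms-reverse (x ∷ xs) h = begin
  ∑ (concatMap (insertions x) (perms xs)) (h ∘ reverse)      ≡⟨ ∑-concatMap (insertions x) (perms xs) (h ∘ reverse) ⟩
  ∑ (perms xs) (λ t → ∑ (insertions x t) (h ∘ reverse))      ≡⟨ ∑-cong (perms xs) (λ t → ∑-insertions-reverse x t h) ⟩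
  ∑ (perms xs) (λ t → ∑ (insertions x (reverse t)) h)        ≡⟨ ∑-perms-reverse xs (λ t → ∑ (insertions x t) h) ⟩
  ∑ (perms xs) (λ t → ∑ (insertions x t) h)                  ≡⟨ ∑-concatMap (insertions x) (perms xs) h ⟨
  ∑ (concatMap (insertions x) (perms xs)) h                  ∎
  where open ≡-Reasoning

range1-unique : ∀ m → Unique (range1 m)
range1-unique m = Unique.map⁺ ℕ.suc-injective (Unique.upTo⁺ m)

elemsP-unique : ∀ α → Unique (elemsP α)
elemsP-unique α = AllPairs.concat⁺
  (All.map⁺ (All.universal (λ a → Unique.map⁺ (cong proj₂) (range1-unique (count a α))) (range1 (sum α))))
  (AllPairs.map⁺ (AllPairs.map
    (λ {a} {b} a≢b → All.map⁺ (All.universal (λ k → All.map⁺ (All.universal (λ l eq → a≢b (cong proj₁ eq)) (range1 (count b α)))) (range1 (count a α))))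
    (range1-unique (sum α))))

linExts-unique : ∀ α → All Unique (linExts α)
linExts-unique α = All.map (λ p → ↭ₛ.Unique-resp-↭ (setoid Elem) (↭⇒↭ₛ (↭.↭-sym p)) (elemsP-unique α)) (perms-↭ (elemsP α))

elemsP-rev : ∀ α → elemsP (rev α) ≡ elemsP α
elemsP-rev α = trans (cong (λ m → concatMap (λ a → map (a ,_) (range1 (count a (rev α)))) (range1 m)) (sum-↭ (↭.↭-reverse α))) (
  concatMap-cong (λ a → cong (map (a ,_) ∘ range1) (↭.↭-length (↭.filter-↭ (ℕ._≟ a) (↭.↭-reverse α)))) (range1 (sum α)))

extensions : List ℕ → List (List Elem)
extensions α = filter (λ s → listEqᵇ (map w s) α Bool.≟ true) (linExts α)

extensions-weights : ∀ α → All (λ s → map w s ≡ α) (extensions α)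
extensions-weights α = All.map (λ {s} → listEqᵇ-true⇒≡ (map w s) α) (All.all-filter (λ s → listEqᵇ (map w s) α Bool.≟ true) (linExts α))

extensions-unique : ∀ α → All Unique (extensions α)
extensions-unique α = All.filter⁺ (λ s → listEqᵇ (map w s) α Bool.≟ true) (linExts-unique α)

-- The antichain depends only on the multiset of parts, so both compositions have the same list of
-- orderings, and reversing a chain reverses its weight sequence.
∑-extensions-rev : ∀ α (h : List Elem → ℤ) → ∑ (extensions (rev α)) h ≡ ∑ (extensions α) (h ∘ reverse)
∑-extensions-rev α h = begin
  ∑ (extensions (rev α)) h                ≡⟨ ∑-filter _ (linExts (rev α)) h ⟩
  ∑ (linExts (rev α)) (select-h (rev α))  ≡⟨ cong (λ xs → ∑ (perms xs) (select-h (rev α))) (elemsP-rev α) ⟩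
  ∑ (linExts α) (select-h (rev α))        ≡⟨ ∑-perms-reverse (elemsP α) (select-h (rev α)) ⟨
  ∑ (linExts α) (select-h (rev α) ∘ reverse)
    ≡⟨ ∑-cong (linExts α) (λ s → cong (λ q → if q then h (reverse s) else + 0) (listEqᵇ-reverse s)) ⟩
  ∑ (linExts α) (λ s → if listEqᵇ (map w s) α then h (reverse s) else + 0)
    ≡⟨ ∑-filter _ (linExts α) (h ∘ reverse) ⟨
  ∑ (extensions α) (h ∘ reverse)          ∎
  where
  open ≡-Reasoning
  select-h : List ℕ → List Elem → ℤ
  select-h β s = if listEqᵇ (map w s) β then h s else + 0
  listEqᵇ-reverse : ∀ s → listEqᵇ (map w (reverse s)) (rev α) ≡ listEqᵇ (map w s) α
  listEqᵇ-reverse s = ⇔⇒≡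
    (λ q → subst (λ β → listEqᵇ (map w s) β ≡ true)
      (reverse-injective (trans (sym (reverse-map w s)) (listEqᵇ-true⇒≡ (map w (reverse s)) (rev α) q)))
      (listEqᵇ-refl (map w s)))
    (λ q → trans (cong₂ listEqᵇ (reverse-map w s) (cong reverse (sym (listEqᵇ-true⇒≡ (map w s) α q))))
      (listEqᵇ-refl (reverse (map w s))))

-- The series as functions of bits

gapSum : Labelling → List ℕ → List Bool → ℤ
gapSum lt α T = ∑ (extensions α) (λ s → ⟦ chainGaps lt s ⟧ T)

extensions-positive : ∀ {n} α → IsComposition n α → All (All (λ u → 1 ≤ w u)) (extensions α)
extensions-positive α (pos , _) =
  All.map (λ eq → All.map⁻ (subst (All (1 ≤_)) (sym eq) pos)) (extensions-weights α)

∑-K-chain : ∀ lt → Transitive lt → ∀ {n} α → IsComposition n α → ∀ e →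
  sumˢ (extensions α) (K-chain lt) e ≡ boolToℤ (sum e ≡ᵇ n) *ℤ gapSum lt α (gaps e)
∑-K-chain lt tr α comp@(pos , refl) e =
  trans (sumˢ-∑ (extensions α) (K-chain lt) e)
    (trans (∑-cong-All (All.map
      (λ {s} (ws , eq) → trans (K-chain-gaps lt tr s e ws)
        (cong (λ β → boolToℤ (sum e ≡ᵇ sum β) *ℤ ⟦ chainGaps lt s ⟧ (gaps e)) eq))
      (All.zip (extensions-positive α comp , extensions-weights α))))
      (∑-*ˡ (boolToℤ (sum e ≡ᵇ sum α)) (extensions α) (λ s → ⟦ chainGaps lt s ⟧ (gaps e))))

-- All extensions in the sum have the same number n - ℓ(α) of letters =, so their signs agree and
-- can be taken out.
Ψ-gapSum : ∀ {lt lt*} → Opposite lt lt* → ∀ {n} α → IsComposition n α → ∀ T →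
  Ψ (gapSum lt α) T ≡ sign (n ∸ length α) *ℤ gapSum lt* α T
Ψ-gapSum {lt} {lt*} op α comp@(_ , refl) T =
  trans (Ψ-∑ (extensions α) (λ s → ⟦ chainGaps lt s ⟧) T)
    (trans (∑-cong-All (All.map
      (λ {s} (ws , eq , uniq) → trans (Ψ-⟦⟧ (chainGaps lt s) T)
        (cong₂ (λ k gs → sign k *ℤ ⟦ gs ⟧ T) (degree s ws eq) (map-dual-chainGaps op s uniq)))
      (All.zip (extensions-positive α comp , All.zip (extensions-weights α , extensions-unique α)))))
      (∑-*ˡ (sign (sum α ∸ length α)) (extensions α) (λ s → ⟦ chainGaps lt* s ⟧ T)))
  where
  degree : ∀ s → All (λ u → 1 ≤ w u) s → map w s ≡ α → equals (chainGaps lt s) ≡ sum α ∸ length α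
  degree s ws refl = trans (sym (ℕ.m+n∸n≡m _ (length s)))
    (cong₂ _∸_ (equals-chainGaps lt s ws) (sym (length-map w s)))

gapSum-reverse : ∀ lt α T → gapSum lt α (reverse T) ≡ gapSum (flip lt) (rev α) T
gapSum-reverse lt α T = trans
  (∑-cong (extensions α) (λ s → trans (sym (⟦⟧-reverse (chainGaps lt s) T))
    (cong (λ gs → ⟦ gs ⟧ T) (chainGaps-reverse lt s))))
  (sym (∑-extensions-rev α (λ s → ⟦ chainGaps (flip lt) s ⟧ T)))

-- With `g` the identity this is an F-expansion with coefficients `c`; `map not`, `reverse` and
-- their composite give its images under ψ, ρ and ω.
bitSum : ℕ → (List ℕ → ℤ) → (List Bool → List Bool) → List Bool → ℤ
bitSum n c g T = ∑ (bits (pred n)) (λ b → c (κ n b) *ℤ ⟨ g b ⟩ T)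

*-rotate : ∀ a b c → a *ℤ (b *ℤ c) ≡ b *ℤ (a *ℤ c)
*-rotate = solve-∀

∑-comps : ∀ n c (h : List ℕ → List ℕ) (g : List Bool → List Bool) → (∀ b → h (κ n b) ≡ κ n (g b)) →
  (∀ b → length (g b) ≡ length b) → ∀ e →
  sumˢ (comps n) (λ β → c β ·ˢ F (h β)) e ≡ boolToℤ (sum e ≡ᵇ n) *ℤ bitSum n c g (gaps e)
∑-comps n c h g hκ lg e = begin
  sumˢ (comps n) (λ β → c β ·ˢ F (h β)) e                    ≡⟨ sumˢ-∑ (comps n) _ e ⟩
  ∑ (comps n) (λ β → c β *ℤ F (h β) e)                       ≡⟨ cong (λ βs → ∑ βs (λ β → c β *ℤ F (h β) e)) (comps-κ n) ⟩
  ∑ (map (κ n) (bits (pred n))) (λ β → c β *ℤ F (h β) e)     ≡⟨ ∑-map (κ n) (bits (pred n)) _ ⟩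
  ∑ (bits (pred n)) (λ b → c (κ n b) *ℤ F (h (κ n b)) e)     ≡⟨ ∑-cong-All (All.map (λ {b} → term b) (bits-length (pred n))) ⟩
  ∑ (bits (pred n)) (λ b → d *ℤ (c (κ n b) *ℤ ⟨ g b ⟩ (gaps e)))  ≡⟨ ∑-*ˡ d (bits (pred n)) _ ⟩
  d *ℤ bitSum n c g (gaps e) ∎
  where
  open ≡-Reasoning
  d = boolToℤ (sum e ≡ᵇ n)
  term : ∀ b → length b ≡ pred n → c (κ n b) *ℤ F (h (κ n b)) e ≡ d *ℤ (c (κ n b) *ℤ ⟨ g b ⟩ (gaps e))
  term b l = trans (cong (c (κ n b) *ℤ_) (trans (cong (λ β → F β e) (hκ b)) (F-κ n (g b) e (trans (lg b) l))))
    (*-rotate (c (κ n b)) d _)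

equals-bits : ∀ b → equals (map fromBit b) ≡ 0
equals-bits []      = refl
equals-bits (t ∷ b) = trans (equals-fromBit t (map fromBit b)) (equals-bits b)

-- Fundamental functions have no letter =, so no sign appears and `Ψ` realises F_α ↦ F_{α^c}.
Ψ-⟨⟩ : ∀ b T → Ψ ⟨ b ⟩ T ≡ ⟨ map not b ⟩ T
Ψ-⟨⟩ b T = trans (Ψ-⟦⟧ (map fromBit b) T) (trans
  (cong₂ (λ k gs → sign k *ℤ ⟦ gs ⟧ T) (equals-bits b)
    (trans (sym (map-∘ b)) (trans (map-cong (sym ∘ dual-fromBit) b) (map-∘ b))))
  (ℤ.*-identityˡ _))

bitSum-not : ∀ n c g T → bitSum n c (map not ∘ g) T ≡ Ψ (bitSum n c g) T
bitSum-not n c g T = sym (trans (Ψ-∑ (bits (pred n)) (λ b U → c (κ n b) *ℤ ⟨ g b ⟩ U) T)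
  (∑-cong (bits (pred n)) (λ b → trans (Ψ-*ˡ (c (κ n b)) ⟨ g b ⟩ T) (cong (c (κ n b) *ℤ_) (Ψ-⟨⟩ (g b) T)))))

bitSum-reverse : ∀ n c T → bitSum n c reverse T ≡ bitSum n c id (reverse T)
bitSum-reverse n c T = ∑-cong (bits (pred n)) (λ b → cong (c (κ n b) *ℤ_)
  (trans (cong (λ gs → ⟦ gs ⟧ T) (reverse-map fromBit b)) (⟦⟧-reverse (map fromBit b) T)))

-- Outside degree n both products are 0, so only words of length n - 1 have to be compared.
*-cong-degree : ∀ n e {x y} → (length (gaps e) ≡ pred n → x ≡ y) →
  boolToℤ (sum e ≡ᵇ n) *ℤ x ≡ boolToℤ (sum e ≡ᵇ n) *ℤ y
*-cong-degree n e p with sum e ≡ᵇ n in eq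
... | true  = cong (+ 1 *ℤ_) (p (trans (length-gaps e) (cong pred (≡ᵇ-true⇒≡ {sum e} {n} eq))))
... | false = refl

-- Existence of an expansion and the three identities

module _ {n : ℕ} (α : List ℕ) (isComp : IsComposition n α) where

  -- Here `β` serves as an exponent list: by `gaps-κ` its ascents recover the bit word that indexes
  -- F_β.
  p-coefficients : List ℕ → ℤ
  p-coefficients β = coeff (gapSum γ-lt α) (gaps β)

  p-expansion : p α ≈ˢ F-expansion n p-coefficients
  p-expansion e = trans (∑-K-chain γ-lt γ-trans α isComp e)
    (trans (*-cong-degree n e (λ l → sym (trans
        (∑-cong-All (All.map (λ {b} l′ → cong (λ b′ → coeff (gapSum γ-lt α) b′ *ℤ ⟨ b ⟩ (gaps e)) (gaps-κ n b l′))
          (bits-length (pred n))))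
        (∑-coeff (pred n) (gapSum γ-lt α) (gaps e) l))))
      (sym (∑-comps n p-coefficients id id (λ _ → refl) (λ _ → refl) e)))

  module _ (c : List ℕ → ℤ) (expansion : p α ≈ˢ F-expansion n c) where

    -- Evaluating the given expansion at the monomial `κ n T`, whose ascents are `T`, turns an
    -- equality of series into one of functions of bits, whatever the coefficients `c` are.
    gapSum≡bitSum : ∀ T → length T ≡ pred n → gapSum γ-lt α T ≡ bitSum n c id T
    gapSum≡bitSum T l = begin
      gapSum γ-lt α T                    ≡⟨ ℤ.*-identityˡ _ ⟨
      + 1 *ℤ gapSum γ-lt α T             ≡⟨ cong₂ (λ d U → boolToℤ d *ℤ gapSum γ-lt α U) degree (gaps-κ n T l) ⟨
      boolToℤ (sum e ≡ᵇ n) *ℤ gapSum γ-lt α (gaps e)  ≡⟨ ∑-K-chain γ-lt γ-trans α isComp e ⟨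
      p α e                              ≡⟨ expansion e ⟩
      F-expansion n c e                  ≡⟨ ∑-comps n c id id (λ _ → refl) (λ _ → refl) e ⟩
      boolToℤ (sum e ≡ᵇ n) *ℤ bitSum n c id (gaps e)  ≡⟨ cong₂ (λ d U → boolToℤ d *ℤ bitSum n c id U) degree (gaps-κ n T l) ⟩
      + 1 *ℤ bitSum n c id T             ≡⟨ ℤ.*-identityˡ _ ⟩
      bitSum n c id T                    ∎
      where
      open ≡-Reasoning
      e = κ n T
      degree : (sum e ≡ᵇ n) ≡ true
      degree = ≡⇒≡ᵇ-true (sum-κ n T l)

    isComp-rev : IsComposition n (rev α)
    isComp-rev = ↭.All-resp-↭ (↭.↭-sym (↭.↭-reverse α)) (proj₁ isComp) , trans (sum-↭ (↭.↭-reverse α)) (proj₂ isComp)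

    signed : ∀ e k x → boolToℤ (sum e ≡ᵇ n) *ℤ (sign k *ℤ x) ≡ sign k *ℤ (boolToℤ (sum e ≡ᵇ n) *ℤ x)
    signed e k x = *-rotate (boolToℤ (sum e ≡ᵇ n)) (sign k) x

    ψ-p : ψ-expansion n c ≈ˢ sign (n ∸ length α) ·ˢ pʳ α
    ψ-p e = begin
      ψ-expansion n c e
        ≡⟨ ∑-comps n c complement (map not) (complement-κ n) (length-map not) e ⟩
      d *ℤ bitSum n c (map not) (gaps e)
        -- Complementation is pulled out of the sum as `Ψ`; then the arbitrary expansion is replaced
        -- by the sum over chains, on which `Ψ` is known.
        ≡⟨ *-cong-degree n e (λ l → trans (bitSum-not n c id (gaps e)) (trans
             (Ψ-cong (gaps e) (λ U l′ → sym (gapSum≡bitSum U (trans l′ l))))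
             (Ψ-gapSum γ-γ*-opposite α isComp (gaps e)))) ⟩
      d *ℤ (sign (n ∸ length α) *ℤ gapSum γ*-lt α (gaps e))
        ≡⟨ signed e (n ∸ length α) _ ⟩
      sign (n ∸ length α) *ℤ (d *ℤ gapSum γ*-lt α (gaps e))
        ≡⟨ cong (sign (n ∸ length α) *ℤ_) (∑-K-chain γ*-lt <ℕℕ-trans α isComp e) ⟨
      sign (n ∸ length α) *ℤ pʳ α e ∎
      where
      open ≡-Reasoning
      d = boolToℤ (sum e ≡ᵇ n)

    -- Reversing the chains flips the labelling, and `flip γ-lt` is `γ*-lt` by definition. No sign
    -- arises, as the letters themselves are unchanged.
    bitSum-reverse≡gapSum : ∀ T → length T ≡ pred n → bitSum n c reverse T ≡ gapSum γ*-lt (rev α) T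
    bitSum-reverse≡gapSum T l = trans (bitSum-reverse n c T)
      (trans (sym (gapSum≡bitSum (reverse T) (trans (length-reverse T) l))) (gapSum-reverse γ-lt α T))

    ρ-p : ρ-expansion n c ≈ˢ pʳ (rev α)
    ρ-p e = trans (∑-comps n c rev reverse (rev-κ n) length-reverse e)
      (trans (*-cong-degree n e (bitSum-reverse≡gapSum (gaps e)))
        (sym (∑-K-chain γ*-lt <ℕℕ-trans (rev α) isComp-rev e)))

    ω-p : ω-expansion n c ≈ˢ sign (n ∸ length α) ·ˢ p (rev α)
    ω-p e = begin
      ω-expansion n c e
        ≡⟨ ∑-comps n c transpose (map not ∘ reverse)
             (λ b → trans (cong complement (rev-κ n b)) (complement-κ n (reverse b)))
             (λ b → trans (length-map not (reverse b)) (length-reverse b)) e ⟩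
      d *ℤ bitSum n c (map not ∘ reverse) (gaps e)
        -- Reversal has already turned γ into γ*, and `Ψ` now turns γ* back into γ, so ω stays
        -- within the family of the p's.
        ≡⟨ *-cong-degree n e (λ l → trans (bitSum-not n c reverse (gaps e)) (trans
             (Ψ-cong (gaps e) (λ U l′ → bitSum-reverse≡gapSum U (trans l′ l)))
             (Ψ-gapSum γ*-γ-opposite (rev α) isComp-rev (gaps e)))) ⟩
      d *ℤ (sign (n ∸ length (rev α)) *ℤ gapSum γ-lt (rev α) (gaps e))
        ≡⟨ signed e (n ∸ length (rev α)) _ ⟩
      sign (n ∸ length (rev α)) *ℤ (d *ℤ gapSum γ-lt (rev α) (gaps e))
        ≡⟨ cong₂ (λ k x → sign (n ∸ k) *ℤ x) (length-reverse α) (sym (∑-K-chain γ-lt γ-trans (rev α) isComp-rev e)) ⟩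
      sign (n ∸ length α) *ℤ p (rev α) e ∎
      where
      open ≡-Reasoning
      d = boolToℤ (sum e ≡ᵇ n)

theorem5p7 : (n : ℕ) (α : List ℕ) → IsComposition n α →
    Σ (List ℕ → ℤ) (λ c → p α ≈ˢ F-expansion n c)
    × ((c : List ℕ → ℤ) → p α ≈ˢ F-expansion n c →
    (ψ-expansion n c ≈ˢ sign (n ∸ length α) ·ˢ pʳ α)
    × (ρ-expansion n c ≈ˢ pʳ (rev α))
    × (ω-expansion n c ≈ˢ sign (n ∸ length α) ·ˢ p (rev α)))
theorem5p7 n α isComp =
  (p-coefficients α isComp , p-expansion α isComp) ,
  λ c expansion → ψ-p α isComp c expansion , ρ-p α isComp c expansion , ω-p α isComp c expansion
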